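{- Let $\mathcal G=\bigl(\ast_{i\in I}\mathbb Z\bigr)\ast\bigl(\ast_{j\in J}\mathbb Z/2\mathbb Z\bigr)$ with its standard generating system $X$, let $\mathcal H\le\mathcal G$ and $\Gamma=\mathrm{Sch}(\mathcal G,\mathcal H,X)$. Then $\Gamma$ is isomorphic (as an unlabeled, unrooted graph) to a Cayley graph if and only if there exist a group $\mathcal G_1=\bigl(\ast_{i\in I_1}\mathbb Z\bigr)\ast\bigl(\ast_{j\in J_1}\mathbb Z/2\mathbb Z\bigr)$ with standard generating system $X_1$, having the same degree as $\mathcal G$, and a normal subgroup $\mathcal N\trianglelefteq\mathcal G_1$ which is length-isomorphic to $\mathcal H$.
   Context: For a family of copies of $\mathbb Z$ indexed by $I$ and of $\mathbb Z/2\mathbb Z$ indexed by $J$, the group $\bigl(\ast_{I}\mathbb Z\bigr)\ast\bigl(\ast_{J}\mathbb Z/2\mathbb Z\bigr)=\langle x_i,y_j\mid y_j^2\rangle$ has standard generating system $\{x_i\}\sqcup\{y_j\}$. Graphs have vertex set, edge set, initial-vertex map and involution $e\mapsto\bar e$; loops, multiple edges and edges with $\bar e=e$ are allowed. For a group $\mathcal A$ with generating system (multiset) $X$, the Schreier graph $\mathrm{Sch}(\mathcal A,\mathcal H,X)$ has vertices the right cosets $\mathcal Hg$ and, for each coset and each $x$ with $x\in X$ or $x^{ -1}\in X$, an edge labeled $x$ from $\mathcal Hg$ to $\mathcal Hgx$ with inverse the edge labeled $x^{ -1}$ from $\mathcal Hgx$; the Cayley graph is $\mathrm{Sch}(\mathcal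 A,\{1\},X)$. A graph is a Cayley graph if it is isomorphic as an unlabeled unrooted graph to some Cayley graph. The degree of a group with respect to a generating system $X$ is the number of $x\in X$ of order at most $2$ plus twice the number of $x\in X$ of order at least $3$. Length $|g|_X$ is the minimal number of factors in $X\cup X^{ -1}$ needed to write $g$; subgroups $\mathcal H\le\mathcal G$, $\mathcal N\le\mathcal G_1$ are length-isomorphic if there is an isomorphism $\alpha:\mathcal H\to\mathcal N$ with $|\alpha(h)|_{X_1}=|h|_X$ for all $h$.
   Formalization: The "if" direction is proved only for G of finite degree (it fails for infinite degree: H=⟨x_1,x_2,…⟩ in the free group on x_0,x_1,…), and in Cayley graphs a generator equal to 1 may give either one loop with ē=e or a pair of mutually inverse loops (either convention alone makes the claim false). -}

module Defs where

open import Level using (0ℓ; suc)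
open import Algebra.Bundles using (Group; RawGroup)
open import Algebra.Structures using (IsGroup)
open import Algebra.Morphism.Structures using (module GroupMorphisms)
import Algebra.Definitions.RawMonoid as RawMonoidDefs
import Algebra.Morphism.GroupMonomorphism as GroupMonomorphism
import Algebra.Properties.Group as GroupProperties
open import Data.Bool using (Bool)
open import Data.Empty using (⊥-elim)
open import Data.Fin using (Fin)
open import Data.List using (List; []; _∷_; _++_; length; foldr)
open import Data.List.Properties using (++-assoc; ++-identityʳ)
open import Data.Nat using (ℕ; _≤_; z≤n; s≤s)
open import Data.Product using (Σ; Σ-syntax; ∃-syntax; _×_; _,_; proj₁; proj₂)
open import Data.Sign using (Sign; opposite) renaming (+ to pos; - to neg)
open import Data.Sum using (_⊎_; inj₁; inj₂)
open import Function using (_⇔_; Inverse; Func; id)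
open import Relation.Binary using (Rel; Setoid; IsEquivalence)
open import Relation.Binary.Construct.Closure.Equivalence as EqC using (EqClosure)
import Relation.Binary.Construct.On as On
open import Relation.Binary.PropositionalEquality
  using (_≡_; refl; sym; trans; cong; subst₂; setoid)
open import Relation.Nullary using (¬_)
import Relation.Binary.Reasoning.Setoid as SetoidReasoning

------------------------------------------------------------------------
-- Graphs

record Graph : Set₁ where
  field
    V       : Setoid 0ℓ 0ℓ
    E       : Setoid 0ℓ 0ℓ
    init    : Func E V
    bar     : Func E E
    bar-bar : ∀ e → Setoid._≈_ E (Func.to bar (Func.to bar e)) e

infix 4 _≅_

record _≅_ (Γ Δ : Graph) : Set where
  private
    module Γ = Graph Γ
    module Δ = Graph Δ
  field
    onV      : Inverse Γ.V Δ.V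
    onE      : Inverse Γ.E Δ.E
    init-hom : ∀ e → Setoid._≈_ Δ.V (Func.to Δ.init (Inverse.to onE e))
                                    (Inverse.to onV (Func.to Γ.init e))
    bar-hom  : ∀ e → Setoid._≈_ Δ.E (Func.to Δ.bar (Inverse.to onE e))
                                    (Inverse.to onE (Func.to Γ.bar e))

------------------------------------------------------------------------
-- Subgroups

record Subgroup (A : Group 0ℓ 0ℓ) : Set₁ where
  open Group A
  field
    Mem      : Carrier → Set
    Mem-resp : ∀ {g h} → g ≈ h → Mem g → Mem h
    Mem-ε    : Mem ε
    Mem-∙    : ∀ {g h} → Mem g → Mem h → Mem (g ∙ h)
    Mem-⁻¹   : ∀ {g} → Mem g → Mem (g ⁻¹)

Normal : {A : Group 0ℓ 0ℓ} → Subgroup A → Set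
Normal {A} N = ∀ g {n} → Mem n → Mem ((g ∙ n) ∙ g ⁻¹)
  where open Group A
        open Subgroup N

trivialSubgroup : (A : Group 0ℓ 0ℓ) → Subgroup A
trivialSubgroup A = record
  { Mem      = λ g → g ≈ ε
  ; Mem-resp = λ g≈h g≈ε → A.trans (A.sym g≈h) g≈ε
  ; Mem-ε    = A.refl
  ; Mem-∙    = λ p q → A.trans (∙-cong p q) (identityˡ ε)
  ; Mem-⁻¹   = λ p → A.trans (⁻¹-cong p) ε⁻¹≈ε
  }
  where module A = Group A
        open Group A using (_≈_; ε; ∙-cong; ⁻¹-cong; identityˡ)
        open GroupProperties A using (ε⁻¹≈ε)

module _ {A : Group 0ℓ 0ℓ} (H : Subgroup A) where
  open Group A
  open Subgroup H

  subgroupRaw : RawGroup 0ℓ 0ℓ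
  subgroupRaw = record
    { Carrier = Σ Carrier Mem
    ; _≈_     = λ g h → proj₁ g ≈ proj₁ h
    ; _∙_     = λ g h → proj₁ g ∙ proj₁ h , Mem-∙ (proj₂ g) (proj₂ h)
    ; ε       = ε , Mem-ε
    ; _⁻¹     = λ g → proj₁ g ⁻¹ , Mem-⁻¹ (proj₂ g)
    }

  subgroupGroup : Group 0ℓ 0ℓ
  subgroupGroup = record
    { RawGroup subgroupRaw
    ; isGroup = GroupMonomorphism.isGroup inclusion isGroup
    }
    where
    inclusion : GroupMorphisms.IsGroupMonomorphism subgroupRaw rawGroup proj₁
    inclusion = record
      { isGroupHomomorphism = record
          { isMonoidHomomorphism = record
              { isMagmaHomomorphism = record
                  { isRelHomomorphism = record { cong = id }
                  ; homo = λ _ _ → Group.refl A }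
              ; ε-homo = Group.refl A }
          ; ⁻¹-homo = λ _ → Group.refl A }
      ; injective = id
      }

  infix 4 _≈coset_

  -- Hg = Hg′ as right cosets.
  _≈coset_ : Rel Carrier 0ℓ
  g ≈coset g′ = Mem (g ∙ g′ ⁻¹)

  private
    open GroupProperties A using (⁻¹-anti-homo-∙; ⁻¹-involutive)
    module R = SetoidReasoning (Group.setoid A)
    module A = Group A

    telescope : ∀ a b c → (a ∙ b ⁻¹) ∙ (b ∙ c) ≈ a ∙ c
    telescope a b c = R.begin
      (a ∙ b ⁻¹) ∙ (b ∙ c)  R.≈⟨ assoc a (b ⁻¹) (b ∙ c) ⟩
      a ∙ (b ⁻¹ ∙ (b ∙ c))  R.≈⟨ ∙-congˡ (A.sym (assoc (b ⁻¹) b c)) ⟩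
      a ∙ ((b ⁻¹ ∙ b) ∙ c)  R.≈⟨ ∙-congˡ (∙-congʳ (inverseˡ b)) ⟩
      a ∙ (ε ∙ c)           R.≈⟨ ∙-congˡ (identityˡ c) ⟩
      a ∙ c                 R.∎

  ≈⇒≈coset : ∀ {g g′} → g ≈ g′ → g ≈coset g′
  ≈⇒≈coset {g} {g′} p =
    Mem-resp (A.sym (A.trans (∙-congʳ p) (inverseʳ g′))) Mem-ε

  ≈coset-∙ : ∀ {g g′} z → g ≈coset g′ → g ∙ z ≈coset g′ ∙ z
  ≈coset-∙ {g} {g′} z = Mem-resp (R.begin
    g ∙ g′ ⁻¹                      R.≈⟨ telescope g (z ⁻¹) (g′ ⁻¹) ⟨
    (g ∙ z ⁻¹ ⁻¹) ∙ (z ⁻¹ ∙ g′ ⁻¹) R.≈⟨ ∙-cong (∙-congˡ (⁻¹-involutive z))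
                                               (A.sym (⁻¹-anti-homo-∙ g′ z)) ⟩
    (g ∙ z) ∙ (g′ ∙ z) ⁻¹          R.∎)

  cosets : Setoid 0ℓ 0ℓ
  cosets = record
    { Carrier = Carrier
    ; _≈_ = _≈coset_
    ; isEquivalence = record
      { refl  = ≈⇒≈coset A.refl
      ; sym   = λ {a} {b} p → Mem-resp
          (A.trans (⁻¹-anti-homo-∙ a (b ⁻¹)) (∙-congʳ (⁻¹-involutive b)))
          (Mem-⁻¹ p)
      ; trans = λ {a} {b} {c} p q → Mem-resp (telescope a b (c ⁻¹)) (Mem-∙ p q)
      }
    }

------------------------------------------------------------------------
-- Generating systems

module _ (A : Group 0ℓ 0ℓ) where
  open Group A
  open RawMonoidDefs rawMonoid renaming (_×_ to power)

  OrderAtMost : ℕ → Carrier → Set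
  OrderAtMost n a = ∃[ m ] (1 ≤ m × m ≤ n × power m a ≈ ε)

  signed : Carrier → Sign → Carrier
  signed a pos = a
  signed a neg = a ⁻¹

  signedProduct : {K : Set} → (K → Carrier) → List (K × Sign) → Carrier
  signedProduct f = foldr (λ { (k , s) b → signed (f k) s ∙ b }) ε

  -- Multisets are families.  SelfInverse k says that the labels x_k and x_k⁻¹
  -- are one and the same: true when x_k has order 2, false when it has order at
  -- least 3.  If x_k = 1 both are allowed, so that x_k contributes at each
  -- vertex either one loop with ē = e or two mutually inverse loops.  Both kinds
  -- must occur among the Cayley graphs of the trivial group for Sch(G, G, X) to
  -- be one when G = ⟨ y ∣ y² ⟩ and when G = ⟨ x ⟩ respectively.
  record GeneratingSystem : Set₁ where
    field
      Index         : Set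
      gen           : Index → Carrier
      generates     : ∀ a → ∃[ w ] signedProduct gen w ≈ a
      SelfInverse   : Index → Set
      self⇒order≤2  : ∀ {k} → SelfInverse k → OrderAtMost 2 (gen k)
      order2⇒self   : ∀ {k} → OrderAtMost 2 (gen k) → ¬ OrderAtMost 1 (gen k) →
                      SelfInverse k

module _ {A : Group 0ℓ 0ℓ} (X : GeneratingSystem A) where
  open Group A hiding (refl; sym; trans; setoid)
  open GeneratingSystem X

  private
    module A = Group A
    open GroupProperties A using (ε⁻¹≈ε; ⁻¹-involutive; inverseˡ-unique)

  Letter± : Set
  Letter± = Index × Sign

  value : Letter± → Carrier
  value (k , s) = signed A (gen k) s

  invert : Letter± → Letter±
  invert (k , s) = k , opposite s

  data _≈label_ : Rel Letter± 0ℓ where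
    same : ∀ {l} → l ≈label l
    fold : ∀ {k s t} → SelfInverse k → (k , s) ≈label (k , t)

  labels : Setoid 0ℓ 0ℓ
  labels = record
    { Carrier = Letter±
    ; _≈_ = _≈label_
    ; isEquivalence = record { refl = same ; sym = sym′ ; trans = trans′ }
    }
    where
    sym′ : ∀ {l m} → l ≈label m → m ≈label l
    sym′ same     = same
    sym′ (fold p) = fold p
    trans′ : ∀ {l m n} → l ≈label m → m ≈label n → l ≈label n
    trans′ same     q        = q
    trans′ (fold p) same     = fold p
    trans′ (fold p) (fold _) = fold p

  order≤2⇒self-inverse : ∀ {a} → OrderAtMost A 2 a → a ≈ a ⁻¹
  order≤2⇒self-inverse (1 , _ , _ , p) =
    A.trans a≈ε (A.sym (A.trans (⁻¹-cong a≈ε) ε⁻¹≈ε))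
    where a≈ε = A.trans (A.sym (identityʳ _)) p
  order≤2⇒self-inverse (2 , _ , _ , p) =
    inverseˡ-unique _ _ (A.trans (∙-congˡ (A.sym (identityʳ _))) p)
  order≤2⇒self-inverse (ℕ.suc (ℕ.suc (ℕ.suc _)) , _ , s≤s (s≤s ()) , _)

  value-cong : ∀ {l m} → l ≈label m → value l ≈ value m
  value-cong same = A.refl
  value-cong (fold {s = pos} {t = pos} p) = A.refl
  value-cong (fold {s = pos} {t = neg} p) = order≤2⇒self-inverse (self⇒order≤2 p)
  value-cong (fold {s = neg} {t = pos} p) = A.sym (order≤2⇒self-inverse (self⇒order≤2 p))
  value-cong (fold {s = neg} {t = neg} p) = A.refl

  invert-cong : ∀ {l m} → l ≈label m → invert l ≈label invert m
  invert-cong same     = same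
  invert-cong (fold p) = fold p

  invert-invert : ∀ l → invert (invert l) ≡ l
  invert-invert (k , pos) = refl
  invert-invert (k , neg) = refl

  value-invert : ∀ l → value l ∙ value (invert l) ≈ ε
  value-invert (k , pos) = inverseʳ (gen k)
  value-invert (k , neg) = inverseˡ (gen k)

  -- The edge (g , l) goes from Hg to H(g · value l); its terminal vertex is
  -- the initial vertex of its inverse.
  Sch : Subgroup A → Graph
  Sch H = record
    { V    = cosets H
    ; E    = record
        { Carrier = Carrier × Letter±
        ; _≈_     = λ e f → g-part e f × l-part e f
        ; isEquivalence = record
          { refl  = C.refl , L.refl
          ; sym   = λ (p , q) → C.sym p , L.sym q
          ; trans = λ (p , q) (p′ , q′) → C.trans p p′ , L.trans q q′
          }
        }
    ; init = record { to = proj₁ ; cong = proj₁ }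
    ; bar  = record
        { to   = λ (g , l) → g ∙ value l , invert l
        ; cong = λ { {g , l} {g′ , l′} (p , q) →
                     C.trans (≈coset-∙ H (value l) p)
                             (≈⇒≈coset H (∙-congˡ (value-cong q)))
                   , invert-cong q }
        }
    ; bar-bar = λ (g , l) →
          ≈⇒≈coset H (A.trans (assoc g (value l) (value (invert l)))
                     (A.trans (∙-congˡ (value-invert l)) (identityʳ g)))
        , L.reflexive (invert-invert l)
    }
    where
    module C = Setoid (cosets H)
    module L = Setoid labels
    g-part l-part : Rel (Carrier × Letter±) 0ℓ
    g-part e f = proj₁ e C.≈ proj₁ f
    l-part e f = proj₂ e L.≈ proj₂ f

  Cay : Graph
  Cay = Sch (trivialSubgroup A)

  HasLength : Carrier → ℕ → Set
  HasLength g n =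
    (∃[ w ] (length w ≡ n × signedProduct A gen w ≈ g)) ×
    (∀ w → signedProduct A gen w ≈ g → n ≤ length w)

  -- A set whose cardinality is the degree: the k with x_k of order at most 2,
  -- and two copies of those with x_k of order at least 3, compared by index.
  degree : Setoid 0ℓ 0ℓ
  degree = On.setoid (setoid (Index ⊎ (Index × Bool))) forget
    where
    Members : Set
    Members = (Σ[ k ∈ Index ] OrderAtMost A 2 (gen k)) ⊎
              ((Σ[ k ∈ Index ] ¬ OrderAtMost A 2 (gen k)) × Bool)
    forget : Members → Index ⊎ (Index × Bool)
    forget (inj₁ (k , _))       = inj₁ k
    forget (inj₂ ((k , _) , b)) = inj₂ (k , b)

IsCayley : Graph → Set₁
IsCayley Γ = Σ[ A ∈ Group 0ℓ 0ℓ ] Σ[ X ∈ GeneratingSystem A ] Γ ≅ Cay X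

SameDegree : {A B : Group 0ℓ 0ℓ} → GeneratingSystem A → GeneratingSystem B → Set
SameDegree X Y = Inverse (degree X) (degree Y)

-- Needed to recover Sch from lengths: the subgroups ⟨ x₁ , x₂ , … ⟩ and ⟨ x₀ , x₁ , … ⟩
-- of the free group on x₀ , x₁ , … are length-isomorphic and the latter is
-- normal, but the Schreier graph of the former is not vertex-transitive.
FiniteDegree : {A : Group 0ℓ 0ℓ} → GeneratingSystem A → Set
FiniteDegree X = ∃[ d ] Inverse (degree X) (setoid (Fin d))

LengthIsomorphic : {A B : Group 0ℓ 0ℓ} → GeneratingSystem A → Subgroup A →
                   GeneratingSystem B → Subgroup B → Set
LengthIsomorphic X H Y N =
  Σ[ α ∈ (Group.Carrier (subgroupGroup H) → Group.Carrier (subgroupGroup N)) ]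
    ( GroupMorphisms.IsGroupIsomorphism (Group.rawGroup (subgroupGroup H))
                                        (Group.rawGroup (subgroupGroup N)) α
    × (∀ h n → HasLength X (proj₁ h) n ⇔ HasLength Y (proj₁ (α h)) n) )

------------------------------------------------------------------------
-- The group ⟨ x_i , y_j ∣ y_j² ⟩

module _ (I J : Set) where

  data Letter : Set where
    free  : I → Sign → Letter
    invol : J → Letter

  letter⁻¹ : Letter → Letter
  letter⁻¹ (free i s) = free i (opposite s)
  letter⁻¹ (invol j)  = invol j

  data Cancel : Rel (List Letter) 0ℓ where
    cancel : ∀ u l v → Cancel (u ++ l ∷ letter⁻¹ l ∷ v) (u ++ v)

  word⁻¹ : List Letter → List Letter
  word⁻¹ []      = []
  word⁻¹ (l ∷ w) = word⁻¹ w ++ letter⁻¹ l ∷ []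

  infix 4 _≈word_
  _≈word_ : Rel (List Letter) 0ℓ
  _≈word_ = EqClosure Cancel

  private
    wordSetoid : Setoid 0ℓ 0ℓ
    wordSetoid = EqC.setoid Cancel
    module W = Setoid wordSetoid
    module R = SetoidReasoning wordSetoid

  letter⁻¹-involutive : ∀ l → letter⁻¹ (letter⁻¹ l) ≡ l
  letter⁻¹-involutive (free i pos) = refl
  letter⁻¹-involutive (free i neg) = refl
  letter⁻¹-involutive (invol j)    = refl

  ++-congˡ : ∀ a {u v} → u ≈word v → (a ++ u) ≈word (a ++ v)
  ++-congˡ a = EqC.gmap (a ++_) λ { (cancel u l v) →
    subst₂ Cancel (++-assoc a u _) (++-assoc a u v) (cancel (a ++ u) l v) }

  ++-congʳ : ∀ a {u v} → u ≈word v → (u ++ a) ≈word (v ++ a)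
  ++-congʳ a = EqC.gmap (_++ a) λ { (cancel u l v) →
    subst₂ Cancel (sym (++-assoc u _ a)) (sym (++-assoc u v a)) (cancel u l (v ++ a)) }

  ++-cong : ∀ {u u′ v v′} → u ≈word u′ → v ≈word v′ → (u ++ v) ≈word (u′ ++ v′)
  ++-cong {u′ = u′} {v = v} p q = W.trans (++-congʳ v p) (++-congˡ u′ q)

  word-step : ∀ u l v → (u ++ l ∷ letter⁻¹ l ∷ v) ≈word (u ++ v)
  word-step u l v = EqC.return (cancel u l v)

  right-inverse : ∀ w → (w ++ word⁻¹ w) ≈word []
  right-inverse []      = W.refl
  right-inverse (l ∷ w) = R.begin
    l ∷ (w ++ (word⁻¹ w ++ letter⁻¹ l ∷ []))
      R.≡⟨ cong (l ∷_) (++-assoc w (word⁻¹ w) _) ⟨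
    l ∷ ((w ++ word⁻¹ w) ++ letter⁻¹ l ∷ [])
      R.≈⟨ ++-congˡ (l ∷ []) (++-congʳ (letter⁻¹ l ∷ []) (right-inverse w)) ⟩
    l ∷ letter⁻¹ l ∷ []
      R.≈⟨ word-step [] l [] ⟩
    [] R.∎

  left-inverse : ∀ w → (word⁻¹ w ++ w) ≈word []
  left-inverse []      = W.refl
  left-inverse (l ∷ w) = R.begin
    (word⁻¹ w ++ letter⁻¹ l ∷ []) ++ l ∷ w
      R.≡⟨ ++-assoc (word⁻¹ w) _ _ ⟩
    word⁻¹ w ++ letter⁻¹ l ∷ l ∷ w
      R.≡⟨ cong (λ m → word⁻¹ w ++ letter⁻¹ l ∷ m ∷ w) (letter⁻¹-involutive l) ⟨
    word⁻¹ w ++ letter⁻¹ l ∷ letter⁻¹ (letter⁻¹ l) ∷ w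
      R.≈⟨ word-step (word⁻¹ w) (letter⁻¹ l) w ⟩
    word⁻¹ w ++ w
      R.≈⟨ left-inverse w ⟩
    [] R.∎

  word⁻¹-cong : ∀ {u v} → u ≈word v → word⁻¹ u ≈word word⁻¹ v
  word⁻¹-cong {u} {v} p = R.begin
    word⁻¹ u                   R.≡⟨ ++-identityʳ (word⁻¹ u) ⟨
    word⁻¹ u ++ []             R.≈⟨ ++-congˡ (word⁻¹ u) (right-inverse v) ⟨
    word⁻¹ u ++ (v ++ word⁻¹ v) R.≡⟨ ++-assoc (word⁻¹ u) v (word⁻¹ v) ⟨
    (word⁻¹ u ++ v) ++ word⁻¹ v R.≈⟨ ++-congʳ (word⁻¹ v) (++-congˡ (word⁻¹ u) p) ⟨
    (word⁻¹ u ++ u) ++ word⁻¹ v R.≈⟨ ++-congʳ (word⁻¹ v) (left-inverse u) ⟩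
    word⁻¹ v                   R.∎

  freeProduct : Group 0ℓ 0ℓ
  freeProduct = record
    { Carrier = List Letter
    ; _≈_ = _≈word_
    ; _∙_ = _++_
    ; ε   = []
    ; _⁻¹ = word⁻¹
    ; isGroup = record
      { isMonoid = record
        { isSemigroup = record
          { isMagma = record { isEquivalence = W.isEquivalence ; ∙-cong = ++-cong }
          ; assoc = λ u v w → W.reflexive (++-assoc u v w) }
        ; identity = (λ _ → W.refl) , λ w → W.reflexive (++-identityʳ w) }
      ; inverse = left-inverse , right-inverse
      ; ⁻¹-cong = word⁻¹-cong }
    }

  standardGen : I ⊎ J → List Letter
  standardGen (inj₁ i) = free i pos ∷ []
  standardGen (inj₂ j) = invol j ∷ []

  standard : GeneratingSystem freeProduct
  standard = record
    { Index        = I ⊎ J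
    ; gen          = standardGen
    ; generates    = generates
    ; SelfInverse  = λ k → OrderAtMost freeProduct 2 (standardGen k)
    ; self⇒order≤2 = id
    ; order2⇒self  = λ p _ → p
    }
    where
    generates : ∀ w → ∃[ v ] signedProduct freeProduct standardGen v ≈word w
    generates [] = [] , W.refl
    generates (free i pos ∷ w) with generates w
    ... | v , p = (inj₁ i , pos) ∷ v , ++-congˡ (free i pos ∷ []) p
    generates (free i neg ∷ w) with generates w
    ... | v , p = (inj₁ i , neg) ∷ v , ++-congˡ (free i neg ∷ []) p
    generates (invol j ∷ w) with generates w
    ... | v , p = (inj₂ j , pos) ∷ v , ++-congˡ (invol j ∷ []) p

LengthIsomorphicToNormal : (I J : Set) → Subgroup (freeProduct I J) → Set₁
LengthIsomorphicToNormal I J H =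
  Σ[ I₁ ∈ Set ] Σ[ J₁ ∈ Set ]
    ( SameDegree (standard I J) (standard I₁ J₁)
    × Σ[ N ∈ Subgroup (freeProduct I₁ J₁) ]
        (Normal N × LengthIsomorphic (standard I J) H (standard I₁ J₁) N) )

{-# OPTIONS --safe #-}

-- Labelled closed paths of a Schreier graph are the words of the subgroup, so an isomorphism
-- Sch(G, H) ≅ Cay(A, Y) transports words letter by letter: this preserves word length and
-- cancellation, and sends H onto the kernel of the free product on Y → A.
--
-- Conversely let α : H → N preserve length.  Call g and g₁ equidistant if |hg| = |α(h)g₁| for
-- all h ∈ H.  Since |hk⁻¹| < |hg| + |kg| exactly when hg and kg end with the same letter, for
-- equidistant g, g₁ the last letters of the hg and of the α(h)g₁ determine each other, so
-- last(hg) ↦ last(α(h)g₁) is a partial bijection of letters; finiteness of the degree extends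
-- it, in a way that only depends on the orbit of (g , g₁), to a bijection telling how to continue
-- from (g , g₁) to equidistant neighbours.  Starting at (1 , 1) this defines an H-equivariant
-- isomorphism of the two Cayley trees, hence Sch(G, H) ≅ Sch(G₁, N).  The latter is a Cayley
-- graph of G₁/N once each free generator whose image has order 2 is taken twice.

module Submission where

open import Defs
open import Level using (0ℓ)
open import Algebra.Bundles using (Group)
open import Algebra.Morphism.Structures using (module GroupMorphisms)
import Algebra.Properties.Group as GroupProperties
open import Axiom.ExcludedMiddle using (ExcludedMiddle)
open import Data.Bool using (Bool; true; false)
open import Data.Empty using (⊥-elim)
open import Data.Fin using (Fin; toℕ)
open import Data.Fin.Properties using (toℕ<n; toℕ-injective; nonZeroIndex)
open import Data.Integer as ℤ using (ℤ; +_; -[1+_])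
import Data.Integer.Properties as ℤ
open import Data.List
  using (List; []; _∷_; _++_; length; head; map; reverse; filter; cartesianProduct; allFin)
open import Data.List.Membership.Propositional using (_∈_)
open import Data.List.Membership.Propositional.Properties
  using (∈-filter⁺; ∈-cartesianProduct⁺; ∈-map⁺; ∈-allFin)
open import Data.List.Properties
  using (++-assoc; ++-identityʳ; length-map; length-reverse; unfold-reverse; filter-≐;
         reverse-++; reverse-involutive)
open import Data.List.Relation.Unary.All as All using (All; _∷_)
open import Data.List.Relation.Unary.All.Properties using (all-filter)
open import Data.List.Relation.Unary.Any using (here; there)
open import Data.Maybe using (Maybe; just)
open import Data.Maybe.Properties using (just-injective)
open import Data.Nat
  using (ℕ; suc; _+_; _*_; _≤_; _<_; _<?_; _%_; NonZero; z≤n; s≤s)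
open import Data.Nat.DivMod using ([m+kn]%n≡m%n; m<n⇒m%n≡m)
open import Data.Nat.Induction using (<-rec)
open import Data.Nat.Properties
open import Data.Product using (Σ; ∃; ∃-syntax; _×_; _,_; proj₁; proj₂)
open import Data.Sign as Sign using (Sign; opposite) renaming (+ to pos; - to neg)
open import Data.Sum using (inj₁; inj₂)
open import Data.Unit using (⊤; tt)
open import Function
  using (Inverse; Func; Equivalence; id; _∘_; _⇔_; mk⇔; _↔_; mk↔ₛ′)
import Function.Construct.Composition as Composition
import Function.Construct.Symmetry as Symmetry
open import Relation.Binary using (Setoid)
import Relation.Binary.Construct.Closure.Equivalence as EqC
import Relation.Binary.Reasoning.Setoid as SetoidReasoning
open import Relation.Binary.PropositionalEquality hiding (J)
open import Relation.Nullary using (¬_; Dec; yes; no)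
open import Relation.Nullary.Decidable using (True; False; toWitness; fromWitness)

-- In the Cayley tree `|hg|` is the distance from `h⁻¹` to `g`, and the last letter of `hg` labels
-- the edge by which the geodesic from `h⁻¹` enters `g`. Equidistance thus says that `g` sees the
-- points of `H` as `g₁` sees those of `N`, and the partial bijection compares the directions at the
-- two vertices in which such points lie. Directions without points of `H` are free; the obstacle
-- there is to choose alike at all translates of `(g , g₁)`, since otherwise nothing descends to
-- cosets. No orbit representatives are chosen: the extension is computed from the list of matched
-- pairs, and translates have the same list. Graph isomorphisms need not respect base vertices.
-- Normality makes up for this, as all vertices then have the same closed paths. A free generator
-- `x` whose image has order 2 gives two edges from `g` to `gx`, the edge `x` being inverse to the
-- edge `x⁻¹` at `gx`. A label of order 2 is its own inverse, so two such labels are required, and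
-- the two edges have to be told apart in the same way from both ends.

private variable
  I J I₁ J₁ : Set

Word : Set → Set → Set
Word I J = List (Letter I J)

-- Isomorphisms of graphs

≅-sym : ∀ {Γ Δ} → Γ ≅ Δ → Δ ≅ Γ
≅-sym {Γ} {Δ} φ = record
  { onV      = Symmetry.inverse onV
  ; onE      = Symmetry.inverse onE
  ; init-hom = λ e → Γ.V.sym (Inverse.inverseʳ onV (Δ.V.trans
      (Func.cong Δ.init (Δ.E.sym (Inverse.strictlyInverseˡ onE e)))
      (init-hom (Inverse.from onE e))))
  ; bar-hom  = λ e → Γ.E.sym (Inverse.inverseʳ onE (Δ.E.trans
      (Func.cong Δ.bar (Δ.E.sym (Inverse.strictlyInverseˡ onE e)))
      (bar-hom (Inverse.from onE e))))
  }
  where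
  open _≅_ φ
  module Γ where
    open Graph Γ public
    module V = Setoid V
    module E = Setoid E
  module Δ where
    open Graph Δ public
    module V = Setoid V
    module E = Setoid E

≅-trans : ∀ {Γ Δ Θ} → Γ ≅ Δ → Δ ≅ Θ → Γ ≅ Θ
≅-trans {Θ = Θ} φ ψ = record
  { onV      = Composition.inverse φ.onV ψ.onV
  ; onE      = Composition.inverse φ.onE ψ.onE
  ; init-hom = λ e → Setoid.trans (Graph.V Θ) (ψ.init-hom (Inverse.to φ.onE e))
                       (Inverse.to-cong ψ.onV (φ.init-hom e))
  ; bar-hom  = λ e → Setoid.trans (Graph.E Θ) (ψ.bar-hom (Inverse.to φ.onE e))
                       (Inverse.to-cong ψ.onE (φ.bar-hom e))
  }
  where
  module φ = _≅_ φ
  module ψ = _≅_ ψ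

≡⇒≈ : {u v : Word I J} → u ≡ v → _≈word_ I J u v
≡⇒≈ refl = EqC.reflexive _

-- Sch (standard I J) H with x_i , x_i⁻¹ and y_j as labels, compared by ≡.
letterGraph : Subgroup (freeProduct I J) → Graph
letterGraph {I} {J} H = record
  { V    = cosets H
  ; E    = record
      { Carrier = Word I J × Letter I J
      ; _≈_     = λ e f → (proj₁ e C.≈ proj₁ f) × (proj₂ e ≡ proj₂ f)
      ; isEquivalence = record
        { refl  = λ {e} → C.refl {proj₁ e} , refl
        ; sym   = λ {e} {f} (p , q) → C.sym {proj₁ e} {proj₁ f} p , sym q
        ; trans = λ {e} {f} {k} (p , q) (p′ , q′) →
            C.trans {proj₁ e} {proj₁ f} {proj₁ k} p p′ , trans q q′
        }
      }
  ; init = record { to = proj₁ ; cong = proj₁ }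
  ; bar  = record
      { to   = λ (g , l) → g ++ l ∷ [] , letter⁻¹ I J l
      ; cong = λ { {g , l} {g′ , _} (p , refl) → ≈coset-∙ H {g} {g′} (l ∷ []) p , refl }
      }
  ; bar-bar = λ (g , l) →
        ≈⇒≈coset H (G.trans (G.assoc g (l ∷ []) (letter⁻¹ I J l ∷ []))
                   (G.trans (word-step I J g l []) (G.identityʳ g)))
      , letter⁻¹-involutive I J l
  }
  where
  module C = Setoid (cosets H)
  module G = Group (freeProduct I J)

-- An isomorphism of graphs spelled out at each vertex: the label of a letter may vary with the
-- vertex, as generators of order 2 and relabelled words require. `step` and `label-inv` are
-- compatibility with endpoints and with inversion of edges.
record Labelling (H : Subgroup (freeProduct I J)) {A : Group 0ℓ 0ℓ} (K : Subgroup A)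
                 (X : GeneratingSystem A) : Set where
  open Group A using (Carrier; _∙_)
  field
    vertex       : Word I J → Carrier
    vertex-cong  : ∀ {g g′} → _≈coset_ H g g′ → _≈coset_ K (vertex g) (vertex g′)
    vertex-inj   : ∀ {g g′} → _≈coset_ K (vertex g) (vertex g′) → _≈coset_ H g g′
    vertex-surj  : ∀ a → ∃ λ g → _≈coset_ K (vertex g) a
    label        : Word I J → Letter I J → Letter± X
    label-cong   : ∀ {g g′} l → _≈coset_ H g g′ → _≈label_ X (label g l) (label g′ l)
    letter       : Word I J → Letter± X → Letter I J
    letter-cong  : ∀ g {m n} → _≈label_ X m n → letter g m ≡ letter g n
    label-letter : ∀ g m → _≈label_ X (label g (letter g m)) m
    letter-label : ∀ g l → letter g (label g l) ≡ l
    step         : ∀ g l → _≈coset_ K (vertex g ∙ value X (label g l)) (vertex (g ++ l ∷ []))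
    label-inv    : ∀ g l → _≈label_ X (invert X (label g l)) (label (g ++ l ∷ []) (letter⁻¹ I J l))

labelling⇒≅ : {H : Subgroup (freeProduct I J)} {A : Group 0ℓ 0ℓ} {K : Subgroup A}
              {X : GeneratingSystem A} → Labelling H K X → letterGraph H ≅ Sch X K
labelling⇒≅ {I} {J} {H} {A} {K} {X} λs = record
  { onV      = record
      { to        = vertex
      ; from      = section
      ; to-cong   = vertex-cong
      ; from-cong = section-cong
      ; inverse   = (λ {a} p → K.trans (vertex-cong p) (proj₂ (vertex-surj a)))
                  , section-vertex
      }
  ; onE      = record
      { to        = λ (g , l) → vertex g , label g l
      ; from      = λ (a , m) → section a , letter (section a) m
      ; to-cong   = λ { {g , l} (p , refl) → vertex-cong p , label-cong l p }
      ; from-cong = λ { {a , m} {b , n} (p , q) → section-cong p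
                      , letter-cong′ m (section-cong p) q }
      ; inverse   = (λ { {a , m} (p , refl) →
                       K.trans (vertex-cong p) (proj₂ (vertex-surj a))
                     , L.trans (label-cong _ p) (label-letter (section a) m) })
                  , (λ { {g , l} {a , m} (p , q) →
                       section-vertex p
                     , trans (letter-cong′ m (section-vertex p) q) (letter-label g l) })
      }
  ; init-hom = λ _ → K.refl
  ; bar-hom  = λ (g , l) → step g l , label-inv g l
  }
  where
  open Labelling λs
  module H = Setoid (cosets H)
  module K = Setoid (cosets K)
  module L = Setoid (labels X)
  section : Group.Carrier A → Word I J
  section a = proj₁ (vertex-surj a)
  section-cong : ∀ {a b} → a K.≈ b → section a H.≈ section b
  section-cong {a} {b} p = vertex-inj
    (K.trans (proj₂ (vertex-surj a)) (K.trans p (K.sym (proj₂ (vertex-surj b)))))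
  section-vertex : ∀ {g a} → a K.≈ vertex g → section a H.≈ g
  section-vertex {g} {a} p = vertex-inj (K.trans (proj₂ (vertex-surj a)) p)
  -- That `letter` is constant on cosets is no field of `Labelling`; it follows because `letter` is
  -- inverse to `label`, which is.
  letter-cong′ : ∀ {g h} m {n} → g H.≈ h → m L.≈ n → letter g m ≡ letter h n
  letter-cong′ {g} {h} m {n} p q = trans (letter-cong g (L.trans q (L.trans
    (L.sym (label-letter h n)) (L.sym (label-cong _ p))))) (letter-label g _)

-- Letters of the free product: orders, labels and degree

module _ (I J : Set) where
  private
    G = freeProduct I J
    X = standard I J
    infix 4 _≈_
    _≈_ = _≈word_ I J

  -- The homomorphism to ℤ with `x_i` ↦ 1 and `y_j` ↦ 0; it detects that `x_i` has infinite order.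
  exponent : Letter I J → ℤ
  exponent (free _ pos) = + 1
  exponent (free _ neg) = -[1+ 0 ]
  exponent (invol _)    = + 0

  exponentSum : Word I J → ℤ
  exponentSum []      = + 0
  exponentSum (l ∷ w) = exponent l ℤ.+ exponentSum w

  exponentSum-cong : ∀ {u v} → u ≈ v → exponentSum u ≡ exponentSum v
  exponentSum-cong = EqC.gfold isEquivalence exponentSum
    λ { (cancel u l v) → cancels u l v }
    where
    opposite-exponents : ∀ l → exponent l ℤ.+ exponent (letter⁻¹ I J l) ≡ + 0
    opposite-exponents (free _ pos) = refl
    opposite-exponents (free _ neg) = refl
    opposite-exponents (invol _)    = refl
    cancels : ∀ u l v → exponentSum (u ++ l ∷ letter⁻¹ I J l ∷ v) ≡ exponentSum (u ++ v)
    cancels []      l v = begin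
      exponent l ℤ.+ (exponent (letter⁻¹ I J l) ℤ.+ exponentSum v)
        ≡⟨ ℤ.+-assoc (exponent l) _ _ ⟨
      exponent l ℤ.+ exponent (letter⁻¹ I J l) ℤ.+ exponentSum v
        ≡⟨ cong (ℤ._+ exponentSum v) (opposite-exponents l) ⟩
      + 0 ℤ.+ exponentSum v
        ≡⟨ ℤ.+-identityˡ _ ⟩
      exponentSum v ∎
      where open ≡-Reasoning
    cancels (m ∷ u) l v = cong (λ n → exponent m ℤ.+ n) (cancels u l v)

  free-infinite-order : ∀ i → ¬ OrderAtMost G 2 (standardGen I J (inj₁ i))
  free-infinite-order i (1 , _ , _ , p) with () ← exponentSum-cong p
  free-infinite-order i (2 , _ , _ , p) with () ← exponentSum-cong p
  free-infinite-order i (suc (suc (suc _)) , _ , s≤s (s≤s ()) , _)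

  invol-order≤2 : ∀ j → OrderAtMost G 2 (standardGen I J (inj₂ j))
  invol-order≤2 j = 2 , s≤s z≤n , s≤s (s≤s z≤n) , word-step I J [] (invol j) []

  toLabel : Letter I J → Letter± X
  toLabel (free i s) = inj₁ i , s
  toLabel (invol j)  = inj₂ j , pos

  fromLabel : Letter± X → Letter I J
  fromLabel (inj₁ i , s) = free i s
  fromLabel (inj₂ j , _) = invol j

  toLabel-fromLabel : ∀ m → _≈label_ X (toLabel (fromLabel m)) m
  toLabel-fromLabel (inj₁ _ , _) = same
  toLabel-fromLabel (inj₂ j , _) = fold (invol-order≤2 j)

  fromLabel-toLabel : ∀ l → fromLabel (toLabel l) ≡ l
  fromLabel-toLabel (free _ _) = refl
  fromLabel-toLabel (invol _)  = refl

  fromLabel-cong : ∀ {m n} → _≈label_ X m n → fromLabel m ≡ fromLabel n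
  fromLabel-cong same                 = refl
  fromLabel-cong (fold {k = inj₁ i} p) = ⊥-elim (free-infinite-order i p)
  fromLabel-cong (fold {k = inj₂ j} p) = refl

  value-toLabel : ∀ l → value X (toLabel l) ≡ l ∷ []
  value-toLabel (free _ pos) = refl
  value-toLabel (free _ neg) = refl
  value-toLabel (invol _)    = refl

  invert-toLabel : ∀ l → _≈label_ X (invert X (toLabel l)) (toLabel (letter⁻¹ I J l))
  invert-toLabel (free _ _) = same
  invert-toLabel (invol j)  = fold (invol-order≤2 j)

  standardLabelling : (H : Subgroup G) → Labelling H H X
  standardLabelling H = record
    { vertex       = id
    ; vertex-cong  = id
    ; vertex-inj   = id
    ; vertex-surj  = λ g → g , H.refl {g}
    ; label        = λ _ → toLabel
    ; label-cong   = λ _ _ → same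
    ; letter       = λ _ → fromLabel
    ; letter-cong  = λ _ → fromLabel-cong
    ; label-letter = λ _ → toLabel-fromLabel
    ; letter-label = λ _ → fromLabel-toLabel
    ; step         = λ g l → H.reflexive (cong (g ++_) (value-toLabel l))
    ; label-inv    = λ _ → invert-toLabel
    }
    where module H = Setoid (cosets H)

  -- `x_i` has infinite order and counts twice, once for each sign; `y_j` has order at most 2 and
  -- counts once. Equality of degrees thus becomes a bijection of letters.
  degree↔letters : Inverse (degree X) (setoid (Letter I J))
  degree↔letters = record
    { to        = to
    ; from      = from
    ; to-cong   = λ {a} {b} → to-cong a b
    ; from-cong = λ { refl → refl }
    ; inverse   = (λ {l} {a} p → trans (to-cong a (from l) p) (to-from l))
                , (λ { {a} refl → from-to a })
    }
    where
    D = degree X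
    bit : Sign → Bool
    bit pos = true
    bit neg = false
    sign : Bool → Sign
    sign true  = pos
    sign false = neg
    to : Setoid.Carrier D → Letter I J
    to (inj₁ (inj₁ i , p))       = ⊥-elim (free-infinite-order i p)
    to (inj₁ (inj₂ j , p))       = invol j
    to (inj₂ ((inj₁ i , _) , b)) = free i (sign b)
    to (inj₂ ((inj₂ j , p) , _)) = ⊥-elim (p (invol-order≤2 j))
    from : Letter I J → Setoid.Carrier D
    from (free i s) = inj₂ ((inj₁ i , free-infinite-order i) , bit s)
    from (invol j)  = inj₁ (inj₂ j , invol-order≤2 j)
    to-cong : ∀ a b → Setoid._≈_ D a b → to a ≡ to b
    to-cong (inj₁ (inj₁ i , p)) _ _                            = ⊥-elim (free-infinite-order i p)
    to-cong (inj₁ (inj₂ j , _)) (inj₁ (inj₂ j , _)) refl       = refl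
    to-cong (inj₂ ((inj₁ i , _) , b)) (inj₂ ((inj₁ i , _) , b)) refl = refl
    to-cong (inj₂ ((inj₂ j , p) , _)) _ _                      = ⊥-elim (p (invol-order≤2 j))
    to-from : ∀ l → to (from l) ≡ l
    to-from (free _ pos) = refl
    to-from (free _ neg) = refl
    to-from (invol _)    = refl
    from-to : ∀ a → Setoid._≈_ D (from (to a)) a
    from-to (inj₁ (inj₁ i , p))           = ⊥-elim (free-infinite-order i p)
    from-to (inj₁ (inj₂ j , p))           = refl
    from-to (inj₂ ((inj₁ i , _) , true))  = refl
    from-to (inj₂ ((inj₁ i , _) , false)) = refl
    from-to (inj₂ ((inj₂ j , p) , _))     = ⊥-elim (p (invol-order≤2 j))

backtrack : (H : Subgroup (freeProduct I J)) → ∀ g l →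
            _≈coset_ H ((g ++ l ∷ []) ++ letter⁻¹ I J l ∷ []) g
backtrack {I} {J} H g l = ≈⇒≈coset H (G.trans
  (≡⇒≈ (++-assoc g (l ∷ []) _)) (G.trans (word-step I J g l []) (≡⇒≈ (++-identityʳ g))))
  where module G = Group (freeProduct I J)

-- Relabelling words along isomorphisms of Schreier graphs

-- A recipe for copying paths: at the vertex `Hg` the letter `l` becomes `to g l`. `to-cong` makes
-- this depend on the vertex alone, and `to-inverse` gives an edge traversed backwards the inverse
-- letter.
record LetterBijections {I J : Set} (H : Subgroup (freeProduct I J)) (I₁ J₁ : Set) : Set where
  field
    to         : Word I J → Letter I J → Letter I₁ J₁
    from       : Word I J → Letter I₁ J₁ → Letter I J
    to-from    : ∀ g l → to g (from g l) ≡ l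
    from-to    : ∀ g l → from g (to g l) ≡ l
    to-cong    : ∀ {g g′} → _≈coset_ H g g′ → ∀ l → to g l ≡ to g′ l
    to-inverse : ∀ g l → to (g ++ l ∷ []) (letter⁻¹ I J l) ≡ letter⁻¹ I₁ J₁ (to g l)

  private
    infix 4 _∼_ _≈_ _≈₁_
    _∼_  = _≈coset_ H
    _≈_  = _≈word_ I J
    _≈₁_ = _≈word_ I₁ J₁
    inv  = letter⁻¹ I J
    inv₁ = letter⁻¹ I₁ J₁
    module G = Group (freeProduct I J)
    module G₁ = Group (freeProduct I₁ J₁)

  from-cong : ∀ {g g′} → g ∼ g′ → ∀ l → from g l ≡ from g′ l
  from-cong {g} {g′} p l = begin
    from g l                      ≡⟨ from-to g′ _ ⟨
    from g′ (to g′ (from g l))    ≡⟨ cong (from g′) (to-cong {g} {g′} p _) ⟨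
    from g′ (to g (from g l))     ≡⟨ cong (from g′) (to-from g l) ⟩
    from g′ l                     ∎
    where open ≡-Reasoning

  from-inverse : ∀ g l → from (g ++ from g l ∷ []) (inv₁ l) ≡ inv (from g l)
  from-inverse g l = begin
    from g′ (inv₁ l)                     ≡⟨ cong (from g′ ∘ inv₁) (to-from g l) ⟨
    from g′ (inv₁ (to g (from g l)))     ≡⟨ cong (from g′) (to-inverse g (from g l)) ⟨
    from g′ (to g′ (inv (from g l)))     ≡⟨ from-to g′ _ ⟩
    inv (from g l)                       ∎
    where
    open ≡-Reasoning
    g′ = g ++ from g l ∷ []

  -- The word is read as a path starting at `g`: each letter is translated at the vertex reached so
  -- far, so this is no homomorphism in general.
  relabel : Word I J → Word I J → Word I₁ J₁
  relabel g []      = []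
  relabel g (l ∷ w) = to g l ∷ relabel (g ++ l ∷ []) w

  unrelabel : Word I J → Word I₁ J₁ → Word I J
  unrelabel g []      = []
  unrelabel g (l ∷ w) = from g l ∷ unrelabel (g ++ from g l ∷ []) w

  relabel-unrelabel : ∀ g w → relabel g (unrelabel g w) ≡ w
  relabel-unrelabel g []      = refl
  relabel-unrelabel g (l ∷ w) = cong₂ _∷_ (to-from g l) (relabel-unrelabel _ w)

  unrelabel-relabel : ∀ g w → unrelabel g (relabel g w) ≡ w
  unrelabel-relabel g []      = refl
  unrelabel-relabel g (l ∷ w) = cong₂ _∷_ (from-to g l) (trans
    (cong (λ m → unrelabel (g ++ m ∷ []) (relabel (g ++ l ∷ []) w)) (from-to g l))
    (unrelabel-relabel _ w))

  length-relabel : ∀ g w → length (relabel g w) ≡ length w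
  length-relabel g []      = refl
  length-relabel g (l ∷ w) = cong suc (length-relabel _ w)

  length-unrelabel : ∀ g w → length (unrelabel g w) ≡ length w
  length-unrelabel g []      = refl
  length-unrelabel g (l ∷ w) = cong suc (length-unrelabel _ w)

  relabel-++ : ∀ g u v → relabel g (u ++ v) ≡ relabel g u ++ relabel (g ++ u) v
  relabel-++ g []      v = cong (λ h → relabel h v) (sym (++-identityʳ g))
  relabel-++ g (l ∷ u) v = cong (to g l ∷_) (trans (relabel-++ _ u v)
    (cong (λ h → relabel (g ++ l ∷ []) u ++ relabel h v) (++-assoc g (l ∷ []) u)))

  relabel-∷ʳ : ∀ g l → relabel [] (g ++ l ∷ []) ≡ relabel [] g ++ to g l ∷ []
  relabel-∷ʳ g l = relabel-++ [] g (l ∷ [])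

  relabel-coset : ∀ {g g′} → g ∼ g′ → ∀ w → relabel g w ≡ relabel g′ w
  relabel-coset p []      = refl
  relabel-coset {g} {g′} p (l ∷ w) = cong₂ _∷_ (to-cong {g} {g′} p l)
    (relabel-coset {g ++ l ∷ []} {g′ ++ l ∷ []} (≈coset-∙ H {g} {g′} (l ∷ []) p) w)

  unrelabel-coset : ∀ {g g′} → g ∼ g′ → ∀ w → unrelabel g w ≡ unrelabel g′ w
  unrelabel-coset p []      = refl
  unrelabel-coset {g} {g′} p (l ∷ w)
    rewrite from-cong {g} {g′} p l = cong (_ ∷_)
      (unrelabel-coset {g ++ from g′ l ∷ []} {g′ ++ from g′ l ∷ []}
        (≈coset-∙ H {g} {g′} (from g′ l ∷ []) p) w)

  -- A cancelling pair becomes a cancelling pair by `to-inverse`; after it the path is back at the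
  -- same coset, so the rest is translated as before.
  relabel-cong : ∀ g {u v} → u ≈ v → relabel g u ≈₁ relabel g v
  relabel-cong g = EqC.gfold G₁.isEquivalence (relabel g) λ { (cancel u l v) → cancels g u l v }
    where
    cancels : ∀ g u l v → relabel g (u ++ l ∷ inv l ∷ v) ≈₁ relabel g (u ++ v)
    cancels g [] l v
      rewrite to-inverse g l
            | relabel-coset {(g ++ l ∷ []) ++ inv l ∷ []} {g} (backtrack H g l) v
      = word-step I₁ J₁ [] (to g l) (relabel g v)
    cancels g (m ∷ u) l v = ++-congˡ I₁ J₁ (to g m ∷ []) (cancels _ u l v)

  unrelabel-cong : ∀ g {u v} → u ≈₁ v → unrelabel g u ≈ unrelabel g v
  unrelabel-cong g = EqC.gfold G.isEquivalence (unrelabel g) λ { (cancel u l v) → cancels g u l v }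
    where
    cancels : ∀ g u l v → unrelabel g (u ++ l ∷ inv₁ l ∷ v) ≈ unrelabel g (u ++ v)
    cancels g [] l v
      rewrite from-inverse g l
            | unrelabel-coset {(g ++ from g l ∷ []) ++ inv (from g l) ∷ []} {g}
                (backtrack H g (from g l)) v
      = word-step I J [] (from g l) (unrelabel g v)
    cancels g (m ∷ u) l v = ++-congˡ I J (from g m ∷ []) (cancels _ u l v)

  relabel-injective : ∀ {g h} → relabel [] g ≈₁ relabel [] h → g ≈ h
  relabel-injective {g} {h} p = G.trans (≡⇒≈ (sym (unrelabel-relabel [] g)))
    (G.trans (unrelabel-cong [] p) (≡⇒≈ (unrelabel-relabel [] h)))

  -- The path of `h ∈ H` closes up, so what follows it is translated as from the base vertex; hence
  -- `relabel []` is a homomorphism on `H`.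
  relabel-mem-++ : ∀ {h} → Subgroup.Mem H h → ∀ g →
                   relabel [] (h ++ g) ≡ relabel [] h ++ relabel [] g
  relabel-mem-++ {h} h∈H g = trans (relabel-++ [] h g) (cong (relabel [] h ++_)
    (relabel-coset {h} {[]} (Subgroup.Mem-resp H (G.sym (≡⇒≈ (++-identityʳ h))) h∈H) g))

record Matches {I J I₁ J₁ : Set} {H : Subgroup (freeProduct I J)} (b : LetterBijections H I₁ J₁)
               (N : Subgroup (freeProduct I₁ J₁)) : Set where
  open LetterBijections b
  field
    mem⇒ : ∀ {g} → Subgroup.Mem H g → Subgroup.Mem N (relabel [] g)
    mem⇐ : ∀ {g} → Subgroup.Mem N (relabel [] g) → Subgroup.Mem H g

conjugate-mem⁻ : {A : Group 0ℓ 0ℓ} (N : Subgroup A) → Normal N → ∀ a n → let open Group A in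
                 Subgroup.Mem N ((a ∙ n) ∙ a ⁻¹) → Subgroup.Mem N n
conjugate-mem⁻ {A} N normal a n p = Subgroup.Mem-resp N (begin
  (a ⁻¹ ∙ ((a ∙ n) ∙ a ⁻¹)) ∙ a ⁻¹ ⁻¹   ≈⟨ ∙-congʳ (∙-congˡ (assoc a n (a ⁻¹))) ⟩
  (a ⁻¹ ∙ (a ∙ (n ∙ a ⁻¹))) ∙ a ⁻¹ ⁻¹   ≈⟨ ∙-congʳ (\\-leftDividesʳ a (n ∙ a ⁻¹)) ⟩
  (n ∙ a ⁻¹) ∙ a ⁻¹ ⁻¹                  ≈⟨ //-rightDividesʳ (a ⁻¹) n ⟩
  n                                     ∎) (normal (a ⁻¹) p)
  where
  open Group A hiding (trans)
  open GroupProperties A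
  open SetoidReasoning (Group.setoid A)

module _ {H : Subgroup (freeProduct I J)} {N : Subgroup (freeProduct I₁ J₁)}
         (normal : Normal N) (φ : letterGraph H ≅ letterGraph N) where
  private
    open _≅_ φ
    module G = Group (freeProduct I J)
    module H = Setoid (cosets H)
    module N = Setoid (cosets N)
    module V = Inverse onV
    module E = Inverse onE
    infix 4 _∼_ _∼₁_
    _∼_  = _≈coset_ H
    _∼₁_ = _≈coset_ N
    module EN = Setoid (Graph.E (letterGraph N))

  ≅⇒letterBijections : LetterBijections H I₁ J₁
  ≅⇒letterBijections = record
    { to         = λ g l → proj₂ (E.to (g , l))
    ; from       = λ g l → proj₂ (E.from (V.to g , l))
    ; to-from    = λ g l → proj₂ (EN.trans
        {E.to (g , proj₂ (E.from (V.to g , l)))} {E.to (E.from (V.to g , l))} {V.to g , l}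
        (E.to-cong {g , proj₂ (E.from (V.to g , l))} {E.from (V.to g , l)} (onbase g l , refl))
        (E.strictlyInverseˡ (V.to g , l)))
    ; from-to    = λ g l → proj₂ (E.inverseʳ {g , l} {V.to g , proj₂ (E.to (g , l))}
        (N.sym {proj₁ (E.to (g , l))} {V.to g} (init-hom (g , l)) , refl))
    ; to-cong    = λ {g} {g′} p l → proj₂ (E.to-cong {g , l} {g′ , l} (p , refl))
    ; to-inverse = λ g l → sym (proj₂ (bar-hom (g , l)))
    }
    where
    -- The edge found by `E.from` starts at some representative of the coset `Hg`, not at `g`
    -- itself, where `to` has to be evaluated.
    onbase : ∀ g l → g ∼ proj₁ (E.from (V.to g , l))
    onbase g l = H.sym {p} {g} (H.trans {p} {V.from (V.to p)} {g}
      (H.sym {V.from (V.to p)} {p} (V.strictlyInverseʳ p))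
      (V.inverseʳ {g} {V.to p} (N.trans {V.to p} {proj₁ (E.to e)} {V.to g}
        (N.sym {proj₁ (E.to e)} {V.to p} (init-hom e))
        (proj₁ (E.strictlyInverseˡ (V.to g , l))))))
      where
      e = E.from (V.to g , l)
      p = proj₁ e

  private
    open LetterBijections ≅⇒letterBijections using (to; relabel)

    -- The end of an edge is the start of its reverse, so `bar-hom` and `init-hom` together
    -- transport it.
    step : ∀ g l → V.to (g ++ l ∷ []) ∼₁ V.to g ++ to g l ∷ []
    step g l = N.trans {V.to gl} {proj₁ (E.to e′)} {V.to g ++ to g l ∷ []}
      (N.sym {proj₁ (E.to e′)} {V.to gl} (init-hom e′))
      (N.trans {proj₁ (E.to e′)} {proj₁ (E.to (g , l)) ++ to g l ∷ []} {V.to g ++ to g l ∷ []}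
        (N.sym {proj₁ (E.to (g , l)) ++ to g l ∷ []} {proj₁ (E.to e′)} (proj₁ (bar-hom (g , l))))
        (≈coset-∙ N {proj₁ (E.to (g , l))} {V.to g} (to g l ∷ []) (init-hom (g , l))))
      where
      gl = g ++ l ∷ []
      e′ = gl , letter⁻¹ I J l

    walk : ∀ g w → V.to (g ++ w) ∼₁ V.to g ++ relabel g w
    walk g []      = N.reflexive {V.to (g ++ [])} {V.to g ++ []}
      (trans (cong V.to (++-identityʳ g)) (sym (++-identityʳ (V.to g))))
    walk g (l ∷ w) = N.trans {V.to (g ++ l ∷ w)} {V.to gl ++ relabel gl w} {V.to g ++ relabel g (l ∷ w)}
      (subst (_∼₁ V.to gl ++ relabel gl w) (cong V.to (++-assoc g (l ∷ []) w)) (walk gl w))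
      (subst (V.to gl ++ relabel gl w ∼₁_) (++-assoc (V.to g) (to g l ∷ []) (relabel gl w))
        (≈coset-∙ N {V.to gl} {V.to g ++ to g l ∷ []} (relabel gl w) (step g l)))
      where gl = g ++ l ∷ []

  -- The base vertex may go to any `a`. The copied path of `h` closes up at `Na` iff
  -- `a · relabel [] h · a⁻¹ ∈ N`, which for normal `N` means `relabel [] h ∈ N`.
  ≅⇒matches : Matches ≅⇒letterBijections N
  ≅⇒matches = record
    { mem⇒ = λ {h} h∈H → conjugate-mem⁻ N normal a (relabel [] h)
        (N.trans {a ++ relabel [] h} {V.to h} {a}
          (N.sym {V.to h} {a ++ relabel [] h} (walk [] h))
          (V.to-cong {h} {[]} (Subgroup.Mem-resp H (G.sym (G.identityʳ h)) h∈H)))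
    ; mem⇐ = λ {h} r∈N → Subgroup.Mem-resp H (G.identityʳ h) (H.trans {h} {V.from (V.to h)} {[]}
        (H.sym {V.from (V.to h)} {h} (V.strictlyInverseʳ h))
        (V.inverseʳ {[]} {V.to h} (N.trans {V.to h} {a ++ relabel [] h} {a}
          (walk [] h) (normal a r∈N))))
    }
    where a = V.to []

-- Reduced words

module Norm (em : ExcludedMiddle 0ℓ) {I J : Set} where
  private
    L   = Letter I J
    G   = freeProduct I J
    inv = letter⁻¹ I J
    infix 4 _≈_
    _≈_ = _≈word_ I J
    module G = Group G

    inv-inv = letter⁻¹-involutive I J

  -- A stack is a word read from its last letter backwards.
  push : L → List L → List L
  push l []      = l ∷ []
  push l (m ∷ s) with em {m ≡ inv l}
  ... | yes _ = s
  ... | no  _ = l ∷ m ∷ s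

  run : List L → Word I J → List L
  run s []      = s
  run s (l ∷ w) = run (push l s) w

  Reduced : List L → Set
  Reduced []      = ⊤
  Reduced (l ∷ s) = head s ≢ just (inv l) × Reduced s

  push-cancel : ∀ l s → push l (inv l ∷ s) ≡ s
  push-cancel l s with em {inv l ≡ inv l}
  ... | yes _ = refl
  ... | no  p = ⊥-elim (p refl)

  push-grow : ∀ l s → head s ≢ just (inv l) → push l s ≡ l ∷ s
  push-grow l []      _ = refl
  push-grow l (m ∷ s) p with em {m ≡ inv l}
  ... | yes q = ⊥-elim (p (cong just q))
  ... | no  _ = refl

  push-reduced : ∀ l {s} → Reduced s → Reduced (push l s)
  push-reduced l {[]}    r = (λ ()) , tt
  push-reduced l {m ∷ s} r with em {m ≡ inv l}
  ... | yes _ = proj₂ r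
  ... | no  p = p ∘ just-injective , r

  -- Reducedness matters when `push l` pops `inv l`: the letter beneath is then not `l`, so that
  -- pushing `inv l` restores the stack instead of popping again.
  push-inv-push : ∀ l {s} → Reduced s → push (inv l) (push l s) ≡ s
  push-inv-push l {[]}    r = subst (λ m → push (inv l) (m ∷ []) ≡ []) (inv-inv l) (push-cancel (inv l) [])
  push-inv-push l {m ∷ s} r with em {m ≡ inv l}
  ... | yes refl = push-grow (inv l) s (proj₁ r)
  ... | no  _    = subst (λ k → push (inv l) (k ∷ m ∷ s) ≡ m ∷ s) (inv-inv l)
                         (push-cancel (inv l) (m ∷ s))

  run-++ : ∀ s u v → run s (u ++ v) ≡ run (run s u) v
  run-++ s []      v = refl
  run-++ s (l ∷ u) v = run-++ (push l s) u v

  run-reduced : ∀ w {s} → Reduced s → Reduced (run s w)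
  run-reduced []      r = r
  run-reduced (l ∷ w) r = run-reduced w (push-reduced l r)

  -- Van der Waerden's argument: pushing `l` and then `inv l` is the identity on reduced stacks, so
  -- words act on these through the group. Hence the reduced form `stack w` depends only on the
  -- group element.
  run-cong : ∀ {s} → Reduced s → ∀ {u v} → u ≈ v → run s u ≡ run s v
  run-cong {s} r = EqC.gfold isEquivalence (run s) λ { (cancel u l v) → cancels r u l v }
    where
    cancels : ∀ {s} → Reduced s → ∀ u l v → run s (u ++ l ∷ inv l ∷ v) ≡ run s (u ++ v)
    cancels r []      l v = cong (λ t → run t v) (push-inv-push l r)
    cancels r (m ∷ u) l v = cancels (push-reduced m r) u l v

  stack : Word I J → List L
  stack = run []

  stack-reduced : ∀ w → Reduced (stack w)
  stack-reduced w = run-reduced w tt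

  stack-cong : ∀ {u v} → u ≈ v → stack u ≡ stack v
  stack-cong = run-cong tt

  stack-∷ʳ : ∀ w l → stack (w ++ l ∷ []) ≡ push l (stack w)
  stack-∷ʳ w l = run-++ [] w (l ∷ [])

  reverse-push : ∀ l s → reverse (push l s) ≈ reverse s ++ l ∷ []
  reverse-push l []      = G.refl
  reverse-push l (m ∷ s) with em {m ≡ inv l}
  ... | yes refl = G.sym (G.trans (≡⇒≈ (begin
    reverse (inv l ∷ s) ++ l ∷ []               ≡⟨ cong (_++ l ∷ []) (unfold-reverse (inv l) s) ⟩
    (reverse s ++ inv l ∷ []) ++ l ∷ []         ≡⟨ ++-assoc (reverse s) _ _ ⟩
    reverse s ++ inv l ∷ l ∷ []                 ≡⟨ cong (λ k → reverse s ++ inv l ∷ k ∷ []) (inv-inv l) ⟨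
    reverse s ++ inv l ∷ inv (inv l) ∷ []       ∎))
    (G.trans (word-step I J (reverse s) (inv l) []) (G.identityʳ (reverse s))))
    where open ≡-Reasoning
  ... | no  _    = ≡⇒≈ (unfold-reverse l (m ∷ s))

  reverse-run : ∀ s w → reverse (run s w) ≈ reverse s ++ w
  reverse-run s []      = G.sym (G.identityʳ (reverse s))
  reverse-run s (l ∷ w) = G.trans (reverse-run (push l s) w) (G.trans
    (++-congʳ I J w (reverse-push l s)) (≡⇒≈ (++-assoc (reverse s) (l ∷ []) w)))

  reverse-stack : ∀ w → reverse (stack w) ≈ w
  reverse-stack = reverse-run []

  stack-reverse : ∀ {s} → Reduced s → stack (reverse s) ≡ s
  stack-reverse {[]}    r       = refl
  stack-reverse {l ∷ s} (p , r) = begin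
    stack (reverse (l ∷ s))      ≡⟨ cong stack (unfold-reverse l s) ⟩
    stack (reverse s ++ l ∷ [])  ≡⟨ stack-∷ʳ (reverse s) l ⟩
    push l (stack (reverse s))   ≡⟨ cong (push l) (stack-reverse r) ⟩
    push l s                     ≡⟨ push-grow l s p ⟩
    l ∷ s                        ∎
    where open ≡-Reasoning

  ∥_∥ : Word I J → ℕ
  ∥ w ∥ = length (stack w)

  ∥∥-cong : ∀ {u v} → u ≈ v → ∥ u ∥ ≡ ∥ v ∥
  ∥∥-cong p = cong length (stack-cong p)

  length-push : ∀ l s → length (push l s) ≤ suc (length s)
  length-push l []      = ≤-refl
  length-push l (m ∷ s) with em {m ≡ inv l}
  ... | yes _ = m≤n⇒m≤1+n (n≤1+n (length s))
  ... | no  _ = ≤-refl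

  length-run : ∀ s w → length (run s w) ≤ length w + length s
  length-run s []      = ≤-refl
  length-run s (l ∷ w) = begin
    length (run (push l s) w)     ≤⟨ length-run (push l s) w ⟩
    length w + length (push l s)  ≤⟨ +-monoʳ-≤ (length w) (length-push l s) ⟩
    length w + suc (length s)     ≡⟨ +-suc (length w) (length s) ⟩
    suc (length w + length s)     ∎
    where open ≤-Reasoning

  -- Reduction never lengthens a word, so the reduced form is shortest among all words for the
  -- element; this identifies `∥_∥` with the length.
  ∥∥≤length : ∀ {v w} → v ≈ w → ∥ w ∥ ≤ length v
  ∥∥≤length {v} p = subst₂ _≤_ (∥∥-cong p) (+-identityʳ (length v)) (length-run [] v)

  ∥∥≡0⇒≈[] : ∀ w → ∥ w ∥ ≡ 0 → w ≈ []
  ∥∥≡0⇒≈[] w p with stack w in eq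
  ... | [] = G.trans (G.sym (reverse-stack w)) (≡⇒≈ (cong reverse eq))

  private
    X = standard I J

  signedProduct-letters : ∀ v → signedProduct G (standardGen I J) v ≡ map (fromLabel I J) v
  signedProduct-letters []                    = refl
  signedProduct-letters ((inj₁ _ , pos) ∷ v) = cong (_ ∷_) (signedProduct-letters v)
  signedProduct-letters ((inj₁ _ , neg) ∷ v) = cong (_ ∷_) (signedProduct-letters v)
  signedProduct-letters ((inj₂ _ , pos) ∷ v) = cong (_ ∷_) (signedProduct-letters v)
  signedProduct-letters ((inj₂ _ , neg) ∷ v) = cong (_ ∷_) (signedProduct-letters v)

  map-fromLabel-toLabel : ∀ w → map (fromLabel I J) (map (toLabel I J) w) ≡ w
  map-fromLabel-toLabel []      = refl
  map-fromLabel-toLabel (l ∷ w) = cong₂ _∷_ (fromLabel-toLabel I J l) (map-fromLabel-toLabel w)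

  hasLength-∥∥ : ∀ w → HasLength X w ∥ w ∥
  hasLength-∥∥ w =
      (map (toLabel I J) v
      , trans (length-map (toLabel I J) v) (length-reverse (stack w))
      , G.trans (≡⇒≈ (trans (signedProduct-letters (map (toLabel I J) v)) (map-fromLabel-toLabel v)))
                (reverse-stack w))
    , λ u p → subst (∥ w ∥ ≤_) (length-map (fromLabel I J) u)
        (∥∥≤length (G.trans (≡⇒≈ (sym (signedProduct-letters u))) p))
    where v = reverse (stack w)

  hasLength⇒≡∥∥ : ∀ w n → HasLength X w n → n ≡ ∥ w ∥
  hasLength⇒≡∥∥ w n ((u , refl , p) , min)
    with (v , q , r) , min′ ← hasLength-∥∥ w =
    ≤-antisym (subst (n ≤_) q (min v r)) (min′ u p)

  ≡∥∥⇒hasLength : ∀ w n → n ≡ ∥ w ∥ → HasLength X w n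
  ≡∥∥⇒hasLength w n refl = hasLength-∥∥ w

  -- The inverse of the word stored in a stack, beginning with the inverse of its last letter.
  -- Running it on `stack u` lets cancellation in `u v⁻¹` start with the last letters of `u` and
  -- `v`.
  undo : List L → Word I J
  undo []      = []
  undo (l ∷ s) = inv l ∷ undo s

  reverse-undo : ∀ s → reverse s ++ undo s ≈ []
  reverse-undo []      = G.refl
  reverse-undo (l ∷ s) = G.trans (≡⇒≈ (trans (cong (_++ undo (l ∷ s)) (unfold-reverse l s))
    (++-assoc (reverse s) (l ∷ []) _))) (G.trans (word-step I J (reverse s) l (undo s)) (reverse-undo s))

  undo-stack : ∀ w → undo (stack w) ≈ word⁻¹ I J w
  undo-stack w = GroupProperties.inverseʳ-unique G w (undo (stack w))
    (G.trans (++-congʳ I J (undo (stack w)) (G.sym (reverse-stack w))) (reverse-undo (stack w)))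

  stack-// : ∀ u v → stack (u ++ word⁻¹ I J v) ≡ run (stack u) (undo (stack v))
  stack-// u v = trans (run-++ [] u (word⁻¹ I J v))
    (run-cong (stack-reduced u) (G.sym (undo-stack v)))

  last : Word I J → Maybe L
  last w = head (stack w)

  last-cong : ∀ {u v} → u ≈ v → last u ≡ last v
  last-cong p = cong head (stack-cong p)

  shorten-// : ∀ u v {l} → last u ≡ just l → last v ≡ just l →
               ∥ u ++ word⁻¹ I J v ∥ < ∥ u ∥ + ∥ v ∥
  shorten-// u v p q rewrite stack-// u v with stack u | stack v | p | q
  ... | l ∷ s | l ∷ t | refl | refl = begin
    suc (length (run (push (inv l) (l ∷ s)) (undo t)))
      ≡⟨ cong (λ k → suc (length (run (push (inv l) (k ∷ s)) (undo t)))) (inv-inv l) ⟨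
    suc (length (run (push (inv l) (inv (inv l) ∷ s)) (undo t)))
      ≡⟨ cong (λ r → suc (length (run r (undo t)))) (push-cancel (inv l) s) ⟩
    suc (length (run s (undo t)))             ≤⟨ s≤s (length-run s (undo t)) ⟩
    suc (length (undo t) + length s)          ≡⟨ cong (λ n → suc (n + length s)) (length-undo t) ⟩
    suc (length t + length s)                 ≡⟨ cong suc (+-comm (length t) (length s)) ⟩
    suc (length s + length t)                 ≤⟨ s≤s (+-monoʳ-≤ (length s) (n≤1+n (length t))) ⟩
    suc (length s + suc (length t))           ∎
    where
    open ≤-Reasoning
    length-undo : ∀ t → length (undo t) ≡ length t
    length-undo []      = refl
    length-undo (_ ∷ t) = cong suc (length-undo t)

  additive-// : ∀ u v → (∀ {l} → last u ≡ just l → last v ≢ just l) →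
                ∥ u ++ word⁻¹ I J v ∥ ≡ ∥ u ∥ + ∥ v ∥
  additive-// u v distinct = trans (cong length (stack-// u v))
    (go (stack u) (stack v) (stack-reduced v) distinct)
    where
    go : ∀ s t → Reduced t → (∀ {l} → head s ≡ just l → head t ≢ just l) →
         length (run s (undo t)) ≡ length s + length t
    go s []      _       _ = sym (+-identityʳ (length s))
    go s (l ∷ t) (p , r) d = begin
      length (run (push (inv l) s) (undo t))
        ≡⟨ cong (λ x → length (run x (undo t))) (push-grow (inv l) s
             (λ q → d (trans q (cong just (inv-inv l))) refl)) ⟩
      length (run (inv l ∷ s) (undo t))
        -- The new top `inv l` differs from the head of `t` because the second stack is reduced, so
        -- the condition of no cancellation persists.
        ≡⟨ go (inv l ∷ s) t r (λ { refl q → p q }) ⟩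
      suc (length s) + length t
        ≡⟨ +-suc (length s) (length t) ⟨
      length s + suc (length t) ∎
      where open ≡-Reasoning

  ∥∥-backtrack : ∀ w l → last w ≡ just (inv l) → ∥ w ∥ ≡ suc ∥ w ++ l ∷ [] ∥
  ∥∥-backtrack w l p rewrite stack-∷ʳ w l with stack w | p
  ... | .(inv l) ∷ s | refl = cong (suc ∘ length) (sym (push-cancel l s))

  stack-advance : ∀ w l → last w ≢ just (inv l) → stack (w ++ l ∷ []) ≡ l ∷ stack w
  stack-advance w l p = trans (stack-∷ʳ w l) (push-grow l (stack w) p)

  last-exists : ∀ w {n} → ∥ w ∥ ≡ suc n → ∃[ l ] last w ≡ just l
  last-exists w p with stack w
  ... | l ∷ _ = l , refl

  last⇒stack : ∀ w {l} → last w ≡ just l → ∃[ s ] stack w ≡ l ∷ s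
  last⇒stack w p with stack w | p
  ... | l ∷ s | refl = s , refl

  last⇒suc : ∀ w {l} → last w ≡ just l → ∃[ n ] ∥ w ∥ ≡ suc n
  last⇒suc w p with stack w | p
  ... | l ∷ s | refl = length s , refl

letters↔⇒sameDegree : Inverse (setoid (Letter I J)) (setoid (Letter I₁ J₁)) →
                      SameDegree (standard I J) (standard I₁ J₁)
letters↔⇒sameDegree {I} {J} {I₁} {J₁} f = Composition.inverse (degree↔letters I J)
  (Composition.inverse f (Symmetry.inverse (degree↔letters I₁ J₁)))

-- The bijection at the base vertex suffices.
letterBijections⇒sameDegree : {H : Subgroup (freeProduct I J)} → LetterBijections H I₁ J₁ →
                              SameDegree (standard I J) (standard I₁ J₁)
letterBijections⇒sameDegree b = letters↔⇒sameDegree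
  (mk↔ₛ′ (to []) (from []) (to-from []) (from-to []))
  where open LetterBijections b

module _ {P B : Set} where

  -- The branches receive `True d` or `False d` rather than proofs of `P` or `¬ P`: these have at
  -- most one element, so letters indexed by them are equal as soon as their generators are.
  classify : (d : Dec P) → (True d → B) → (False d → B) → B
  classify (yes _) t f = t tt
  classify (no _)  t f = f tt

  classify-True : ∀ d {t : True d → B} {f : False d → B} x → classify d t f ≡ t x
  classify-True (yes _) tt = refl

  classify-False : ∀ d {t : True d → B} {f : False d → B} x → classify d t f ≡ f x
  classify-False (no _) tt = refl

  classify-true : ∀ d → P → {t : True d → B} {f f′ : False d → B} → classify d t f ≡ classify d t f′
  classify-true (yes _) _ = refl
  classify-true (no ¬p) p = ⊥-elim (¬p p)

  classify-elim : ∀ d {t : True d → B} {f : False d → B} (Q : B → Set) →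
                  (∀ x → Q (t x)) → (∀ x → Q (f x)) → Q (classify d t f)
  classify-elim (yes _) Q qt qf = qt tt
  classify-elim (no _)  Q qt qf = qf tt

-- From Cayley graphs to length isomorphisms

module _ (em : ExcludedMiddle 0ℓ) where

  module _ {H : Subgroup (freeProduct I J)} (b : LetterBijections H I₁ J₁) where
    open LetterBijections b
    private
      module L  = Norm em {I} {J}
      module L₁ = Norm em {I₁} {J₁}
      module G  = Group (freeProduct I J)
      module G₁ = Group (freeProduct I₁ J₁)

    -- Both `relabel` and `unrelabel` keep the number of letters and respect equality in the group,
    -- so shortest words go to shortest words.
    relabel-∥∥ : ∀ g → L₁.∥ relabel [] g ∥ ≡ L.∥ g ∥
    relabel-∥∥ g = ≤-antisym
      (subst (L₁.∥ relabel [] g ∥ ≤_)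
        (trans (length-relabel [] (reverse (L.stack g))) (length-reverse (L.stack g)))
        (L₁.∥∥≤length (relabel-cong [] (L.reverse-stack g))))
      (subst (L.∥ g ∥ ≤_)
        (trans (length-unrelabel [] v) (length-reverse (L₁.stack (relabel [] g))))
        (L.∥∥≤length (G.trans (unrelabel-cong [] (L₁.reverse-stack (relabel [] g)))
          (≡⇒≈ (unrelabel-relabel [] g)))))
      where v = reverse (L₁.stack (relabel [] g))

    matches⇒lengthIsomorphic : {N : Subgroup (freeProduct I₁ J₁)} → Matches b N →
                               LengthIsomorphic (standard I J) H (standard I₁ J₁) N
    matches⇒lengthIsomorphic {N} m =
        (λ (h , h∈H) → relabel [] h , mem⇒ h∈H)
      , record
        { isGroupMonomorphism = record
          { isGroupHomomorphism = record
            { isMonoidHomomorphism = record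
              { isMagmaHomomorphism = record
                { isRelHomomorphism = record { cong = relabel-cong [] }
                ; homo = λ (h , h∈H) (k , _) → ≡⇒≈ (relabel-mem-++ h∈H k)
                }
              ; ε-homo = G₁.refl
              }
            ; ⁻¹-homo = λ (h , h∈H) → GroupProperties.inverseˡ-unique (freeProduct I₁ J₁) _ _
                (G₁.trans (≡⇒≈ (sym (relabel-mem-++ (Subgroup.Mem-⁻¹ H h∈H) h)))
                          (relabel-cong [] (left-inverse I J h)))
            }
          ; injective = relabel-injective
          }
        ; surjective = λ (n , n∈N) →
              (unrelabel [] n
              , mem⇐ (subst (Subgroup.Mem N) (sym (relabel-unrelabel [] n)) n∈N))
            , λ p → G₁.trans (relabel-cong [] p) (≡⇒≈ (relabel-unrelabel [] n))
        }
      , λ (h , _) n → mk⇔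
          (λ p → L₁.≡∥∥⇒hasLength (relabel [] h) n
            (trans (L.hasLength⇒≡∥∥ h n p) (sym (relabel-∥∥ h))))
          (λ p → L.≡∥∥⇒hasLength h n
            (trans (L₁.hasLength⇒≡∥∥ (relabel [] h) n p) (relabel-∥∥ h)))
      where open Matches m

  ≅⇒lengthIsomorphicToNormal : {H : Subgroup (freeProduct I J)} {N : Subgroup (freeProduct I₁ J₁)} →
    Normal N → letterGraph H ≅ letterGraph N → LengthIsomorphicToNormal I J H
  ≅⇒lengthIsomorphicToNormal {I₁ = I₁} {J₁ = J₁} {H = H} {N = N} normal φ =
    I₁ , J₁ , letterBijections⇒sameDegree (≅⇒letterBijections {H = H} {N = N} normal φ)
    , N , normal , matches⇒lengthIsomorphic (≅⇒letterBijections {H = H} {N = N} normal φ)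
                     (≅⇒matches {H = H} {N = N} normal φ)

  module _ {A : Group 0ℓ 0ℓ} (X : GeneratingSystem A) where
    open Group A hiding (refl; sym; trans; setoid)
    open GeneratingSystem X
    private module A = Group A

    -- The split follows `SelfInverse` and not the order: a trivial generator becomes an involution
    -- if it contributes a loop that is its own inverse, and a free generator if it contributes two
    -- mutually inverse loops.
    FreeIndex InvolIndex : Set
    FreeIndex  = Σ Index λ k → False (em {SelfInverse k})
    InvolIndex = Σ Index λ k → True  (em {SelfInverse k})

    private
      L = Letter FreeIndex InvolIndex
      G = freeProduct FreeIndex InvolIndex
      inv = letter⁻¹ FreeIndex InvolIndex
      infix 4 _≈w_
      _≈w_ = _≈word_ FreeIndex InvolIndex

    letterLabel : L → Letter± X
    letterLabel (free (k , _) s) = k , s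
    letterLabel (invol (k , _))  = k , pos

    labelLetter : Letter± X → L
    labelLetter (k , s) = classify em (λ t → invol (k , t)) (λ f → free (k , f) s)

    labelLetter-cong : ∀ {m n} → _≈label_ X m n → labelLetter m ≡ labelLetter n
    labelLetter-cong same     = refl
    labelLetter-cong (fold p) = classify-true em p

    letterLabel-labelLetter : ∀ m → _≈label_ X (letterLabel (labelLetter m)) m
    letterLabel-labelLetter (k , s) = classify-elim em (λ l → _≈label_ X (letterLabel l) (k , s))
      (λ t → fold (toWitness t)) (λ _ → same)

    labelLetter-letterLabel : ∀ l → labelLetter (letterLabel l) ≡ l
    labelLetter-letterLabel (free (k , f) s) = classify-False em f
    labelLetter-letterLabel (invol (k , t))  = classify-True em t

    letterLabel-inv : ∀ l → _≈label_ X (invert X (letterLabel l)) (letterLabel (inv l))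
    letterLabel-inv (free _ _)      = same
    letterLabel-inv (invol (_ , t)) = fold (toWitness t)

    eval : Word FreeIndex InvolIndex → Carrier
    eval []      = ε
    eval (l ∷ w) = value X (letterLabel l) ∙ eval w

    eval-++ : ∀ u v → eval (u ++ v) ≈ eval u ∙ eval v
    eval-++ []      v = A.sym (identityˡ (eval v))
    eval-++ (l ∷ u) v = A.trans (∙-congˡ (eval-++ u v)) (A.sym (assoc _ _ _))

    eval-cong : ∀ {u v} → u ≈w v → eval u ≈ eval v
    eval-cong = EqC.gfold A.isEquivalence eval λ { (cancel u l v) → cancels u l v }
      where
      cancels : ∀ u l v → eval (u ++ l ∷ inv l ∷ v) ≈ eval (u ++ v)
      cancels (m ∷ u) l v = ∙-congˡ (cancels u l v)
      cancels []      l v = begin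
        value X (letterLabel l) ∙ (value X (letterLabel (inv l)) ∙ eval v)
          ≈⟨ assoc _ _ _ ⟨
        (value X (letterLabel l) ∙ value X (letterLabel (inv l))) ∙ eval v
          ≈⟨ ∙-congʳ (∙-congˡ (value-cong X (letterLabel-inv l))) ⟨
        (value X (letterLabel l) ∙ value X (invert X (letterLabel l))) ∙ eval v
          ≈⟨ ∙-congʳ (value-invert X (letterLabel l)) ⟩
        ε ∙ eval v
          ≈⟨ identityˡ _ ⟩
        eval v ∎
        where open SetoidReasoning A.setoid

    eval-⁻¹ : ∀ u → eval (word⁻¹ _ _ u) ≈ eval u ⁻¹
    eval-⁻¹ u = GroupProperties.inverseˡ-unique A _ _
      (A.trans (A.sym (eval-++ (word⁻¹ _ _ u) u)) (eval-cong (left-inverse _ _ u)))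

    kernel : Subgroup G
    kernel = record
      { Mem      = λ w → eval w ≈ ε
      ; Mem-resp = λ p q → A.trans (A.sym (eval-cong p)) q
      ; Mem-ε    = A.refl
      ; Mem-∙    = λ {g} {h} p q → A.trans (eval-++ g h) (A.trans (∙-cong p q) (identityˡ ε))
      ; Mem-⁻¹   = λ {g} p → A.trans (eval-⁻¹ g) (A.trans (⁻¹-cong p) (GroupProperties.ε⁻¹≈ε A))
      }

    kernel-normal : Normal kernel
    kernel-normal g {n} p = begin
      eval ((g ++ n) ++ word⁻¹ _ _ g)     ≈⟨ eval-++ (g ++ n) _ ⟩
      eval (g ++ n) ∙ eval (word⁻¹ _ _ g) ≈⟨ ∙-cong (eval-++ g n) (eval-⁻¹ g) ⟩
      (eval g ∙ eval n) ∙ eval g ⁻¹       ≈⟨ ∙-congʳ (∙-congˡ p) ⟩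
      (eval g ∙ ε) ∙ eval g ⁻¹            ≈⟨ ∙-congʳ (identityʳ _) ⟩
      eval g ∙ eval g ⁻¹                  ≈⟨ inverseʳ _ ⟩
      ε                                   ∎
      where open SetoidReasoning A.setoid

    eval-letters : ∀ w → eval (map labelLetter w) ≈ signedProduct A gen w
    eval-letters []      = A.refl
    eval-letters (m ∷ w) = ∙-cong (value-cong X (letterLabel-labelLetter m)) (eval-letters w)

    -- The cosets of the kernel are the fibres of `eval`, which is onto because `X` generates; so
    -- vertices correspond to elements of `A`.
    kernelLabelling : Labelling kernel (trivialSubgroup A) X
    kernelLabelling = record
      { vertex       = eval
      ; vertex-cong  = λ {g} {g′} p → A.trans (A.sym (eval-// g g′)) p
      ; vertex-inj   = λ {g} {g′} p → A.trans (eval-// g g′) p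
      ; vertex-surj  = λ a → map labelLetter (proj₁ (generates a)) , ≈⇒≈coset (trivialSubgroup A)
          (A.trans (eval-letters (proj₁ (generates a))) (proj₂ (generates a)))
      ; label        = λ _ → letterLabel
      ; label-cong   = λ _ _ → same
      ; letter       = λ _ → labelLetter
      ; letter-cong  = λ _ → labelLetter-cong
      ; label-letter = λ _ → letterLabel-labelLetter
      ; letter-label = λ _ → labelLetter-letterLabel
      ; step         = λ g l → ≈⇒≈coset (trivialSubgroup A)
          (A.sym (A.trans (eval-++ g (l ∷ [])) (∙-congˡ (identityʳ _))))
      ; label-inv    = λ _ → letterLabel-inv
      }
      where
      eval-// : ∀ g g′ → eval (g ++ word⁻¹ _ _ g′) ≈ eval g ∙ eval g′ ⁻¹
      eval-// g g′ = A.trans (eval-++ g _) (∙-congˡ (eval-⁻¹ g′))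

  module _ (H : Subgroup (freeProduct I J)) {A : Group 0ℓ 0ℓ} (X : GeneratingSystem A)
           (φ : Sch (standard I J) H ≅ Cay X) where
    private
      b₁ : letterGraph H ≅ Sch (standard I J) H
      b₁ = labelling⇒≅ {X = standard I J} (standardLabelling I J H)

      b₂ : letterGraph (kernel X) ≅ Cay X
      b₂ = labelling⇒≅ {X = X} (kernelLabelling X)

      ψ : letterGraph H ≅ letterGraph (kernel X)
      ψ = ≅-trans {letterGraph H} {Sch (standard I J) H} {letterGraph (kernel X)} b₁
            (≅-trans {Sch (standard I J) H} {Cay X} {letterGraph (kernel X)} φ
              (≅-sym {letterGraph (kernel X)} {Cay X} b₂))

    cayley⇒lengthIsomorphicToNormal : LengthIsomorphicToNormal I J H
    cayley⇒lengthIsomorphicToNormal =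
      ≅⇒lengthIsomorphicToNormal {H = H} {N = kernel X} (kernel-normal X) ψ

-- From length isomorphisms to graph isomorphisms

module Extend (em : ExcludedMiddle 0ℓ) {A B : Set} (base : A ↔ B) where

  swap : B → B → B → B
  swap x y z with em {z ≡ x} | em {z ≡ y}
  ... | yes _ | _     = y
  ... | no  _ | yes _ = x
  ... | no  _ | no  _ = z

  swap-left : ∀ x y → swap x y x ≡ y
  swap-left x y with em {x ≡ x} | em {x ≡ y}
  ... | yes _ | _ = refl
  ... | no  p | _ = ⊥-elim (p refl)

  swap-right : ∀ x y → swap x y y ≡ x
  swap-right x y with em {y ≡ x} | em {y ≡ y}
  ... | yes p | _     = p
  ... | no  _ | yes _ = refl
  ... | no  _ | no  p = ⊥-elim (p refl)

  swap-fix : ∀ {x y z} → z ≢ x → z ≢ y → swap x y z ≡ z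
  swap-fix {x} {y} {z} p q with em {z ≡ x} | em {z ≡ y}
  ... | yes r | _     = ⊥-elim (p r)
  ... | no  _ | yes r = ⊥-elim (q r)
  ... | no  _ | no  _ = refl

  swap-involutive : ∀ x y z → swap x y (swap x y z) ≡ z
  swap-involutive x y z with em {z ≡ x} | em {z ≡ y}
  ... | yes p | _     = trans (swap-right x y) (sym p)
  ... | no  _ | yes p = trans (swap-left x y) (sym p)
  ... | no  p | no  q = swap-fix p q

  -- Each pair is imposed on the bijection built so far by composing with the transposition of the
  -- present and the desired image of `a`. For fixed `base` the result depends only on the list.
  extend : List (A × B) → A ↔ B
  extend []             = base
  extend ((a , b) ∷ ps) = mk↔ₛ′ (τ ∘ π.to) (π.from ∘ τ)
    (λ y → trans (cong τ (π.strictlyInverseˡ (τ y))) (swap-involutive _ b y))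
    (λ x → trans (cong π.from (swap-involutive _ b (π.to x))) (π.strictlyInverseʳ x))
    where
    module π = Inverse (extend ps)
    τ = swap (π.to a) b

  -- The transposition for `(a , b)` exchanges `π a` and `b`. It does not move the image `d` of
  -- another `c`: `d ≠ π a` because `π` is injective, and `d ≠ b` because the pairs form a partial
  -- bijection.
  extend-∈ : {P : A × B → Set} →
             (∀ {p q} → P p → P q → proj₁ p ≡ proj₁ q → proj₂ p ≡ proj₂ q) →
             (∀ {p q} → P p → P q → proj₂ p ≡ proj₂ q → proj₁ p ≡ proj₁ q) →
             ∀ {ps} → All P ps → ∀ {a b} → (a , b) ∈ ps → Inverse.to (extend ps) a ≡ b
  extend-∈ f g (_ ∷ _)    (here refl) = swap-left _ _
  extend-∈ {P} f g {(a , b) ∷ ps} (pa ∷ pas) {c} {d} (there m) with em {c ≡ a}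
  ... | yes refl = trans (swap-left _ b) (f pa (All.lookup pas m) refl)
  ... | no  c≢a  = trans
    (swap-fix (c≢a ∘ π-injective)
              (λ e → c≢a (g (All.lookup pas m) pa (trans (sym ih) e))))
    ih
    where
    ih = extend-∈ {P} f g pas m
    π-injective : ∀ {x y} → Inverse.to (extend ps) x ≡ Inverse.to (extend ps) y → x ≡ y
    π-injective {x} {y} e = trans (sym (Inverse.strictlyInverseʳ (extend ps) x))
      (trans (cong (Inverse.from (extend ps)) e) (Inverse.strictlyInverseʳ (extend ps) y))

translate-// : (A : Group 0ℓ 0ℓ) → let open Group A in
               ∀ h k g → (h ∙ g) ∙ (k ∙ g) ⁻¹ ≈ h ∙ k ⁻¹
translate-// A h k g = begin
  (h ∙ g) ∙ (k ∙ g) ⁻¹      ≈⟨ ∙-congˡ (⁻¹-anti-homo-∙ k g) ⟩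
  (h ∙ g) ∙ (g ⁻¹ ∙ k ⁻¹)   ≈⟨ assoc h g _ ⟩
  h ∙ (g ∙ (g ⁻¹ ∙ k ⁻¹))   ≈⟨ ∙-congˡ (\\-leftDividesˡ g (k ⁻¹)) ⟩
  h ∙ k ⁻¹                  ∎
  where
  open Group A
  open GroupProperties A
  open SetoidReasoning (Group.setoid A)

module _ (em : ExcludedMiddle 0ℓ) where
  private
    module L  {I} {J} = Norm em {I} {J}

  last-agree : ∀ (u v : Word I J) (u₁ v₁ : Word I₁ J₁) →
    L.∥ u ∥ ≡ L.∥ u₁ ∥ → L.∥ v ∥ ≡ L.∥ v₁ ∥ →
    L.∥ u ++ word⁻¹ I J v ∥ ≡ L.∥ u₁ ++ word⁻¹ I₁ J₁ v₁ ∥ →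
    ∀ {l l₁ m₁} → L.last u ≡ just l → L.last v ≡ just l →
    L.last u₁ ≡ just l₁ → L.last v₁ ≡ just m₁ → l₁ ≡ m₁
  last-agree u v u₁ v₁ p q r {l₁ = l₁} {m₁} ul vl u₁l₁ v₁m₁ with em {l₁ ≡ m₁}
  ... | yes e = e
  ... | no  d = ⊥-elim (<-irrefl
    (trans r (trans (L.additive-// u₁ v₁ λ x y →
      d (just-injective (trans (sym u₁l₁) (trans x (trans (sym y) v₁m₁)))))
      (sym (cong₂ _+_ p q))))
    (L.shorten-// u v ul vl))

module LengthIso
  (em : ExcludedMiddle 0ℓ) {I J I₁ J₁ : Set}
  (H : Subgroup (freeProduct I J)) (N : Subgroup (freeProduct I₁ J₁))
  (α : Group.Carrier (subgroupGroup H) → Group.Carrier (subgroupGroup N))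
  (α-iso : GroupMorphisms.IsGroupIsomorphism (Group.rawGroup (subgroupGroup H))
                                             (Group.rawGroup (subgroupGroup N)) α)
  (α-length : ∀ h n → HasLength (standard I J) (proj₁ h) n ⇔
                      HasLength (standard I₁ J₁) (proj₁ (α h)) n)
  (base : Letter I J ↔ Letter I₁ J₁)
  (ls : List (Letter I J)) (ls-complete : ∀ l → l ∈ ls)
  where

  private
    module L  = Norm em {I} {J}
    module L₁ = Norm em {I₁} {J₁}
    module G  = Group (freeProduct I J)
    module G₁ = Group (freeProduct I₁ J₁)
    module H  = Group (subgroupGroup H)
    module α  = GroupMorphisms.IsGroupIsomorphism α-iso
    open Extend em base
    inv  = letter⁻¹ I J
    inv₁ = letter⁻¹ I₁ J₁
    inv-inv  = letter⁻¹-involutive I J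
    inv-inv₁ = letter⁻¹-involutive I₁ J₁

    ⟨_⟩ : H.Carrier → Word I J
    ⟨ h ⟩ = proj₁ h
    ⟨_⟩₁ : H.Carrier → Word I₁ J₁
    ⟨ h ⟩₁ = proj₁ (α h)

  α-∥∥ : ∀ h → L.∥ ⟨ h ⟩ ∥ ≡ L₁.∥ ⟨ h ⟩₁ ∥
  α-∥∥ h = L₁.hasLength⇒≡∥∥ ⟨ h ⟩₁ _ (Equivalence.to (α-length h _) (L.hasLength-∥∥ ⟨ h ⟩))

  Equidistant : Word I J → Word I₁ J₁ → Set
  Equidistant g g₁ = ∀ h → L.∥ ⟨ h ⟩ ++ g ∥ ≡ L₁.∥ ⟨ h ⟩₁ ++ g₁ ∥

  Matched : Word I J → Word I₁ J₁ → Letter I J × Letter I₁ J₁ → Set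
  Matched g g₁ (l , l₁) =
    ∃[ h ] (L.last (⟨ h ⟩ ++ g) ≡ just l × L₁.last (⟨ h ⟩₁ ++ g₁) ≡ just l₁)

  -- The factor `g` drops out of `(hg)(kg)⁻¹`; what remains is an element of `H`, whose length `α`
  -- preserves.
  equidistant-// : ∀ g g₁ h k →
    L.∥ (⟨ h ⟩ ++ g) ++ word⁻¹ I J (⟨ k ⟩ ++ g) ∥ ≡
    L₁.∥ (⟨ h ⟩₁ ++ g₁) ++ word⁻¹ I₁ J₁ (⟨ k ⟩₁ ++ g₁) ∥
  equidistant-// g g₁ h k = begin
    L.∥ (⟨ h ⟩ ++ g) ++ word⁻¹ I J (⟨ k ⟩ ++ g) ∥
      ≡⟨ L.∥∥-cong (translate-// (freeProduct I J) ⟨ h ⟩ ⟨ k ⟩ g) ⟩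
    L.∥ ⟨ h H.∙ k H.⁻¹ ⟩ ∥
      ≡⟨ α-∥∥ (h H.∙ k H.⁻¹) ⟩
    L₁.∥ ⟨ h H.∙ k H.⁻¹ ⟩₁ ∥
      ≡⟨ L₁.∥∥-cong (G₁.trans (α.∙-homo h (k H.⁻¹)) (G₁.∙-congˡ {⟨ h ⟩₁} (α.⁻¹-homo k))) ⟩
    L₁.∥ ⟨ h ⟩₁ ++ word⁻¹ I₁ J₁ ⟨ k ⟩₁ ∥
      ≡⟨ L₁.∥∥-cong (translate-// (freeProduct I₁ J₁) ⟨ h ⟩₁ ⟨ k ⟩₁ g₁) ⟨
    L₁.∥ (⟨ h ⟩₁ ++ g₁) ++ word⁻¹ I₁ J₁ (⟨ k ⟩₁ ++ g₁) ∥ ∎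
    where open ≡-Reasoning

  matched-functional : ∀ {g g₁} → Equidistant g g₁ → ∀ {p q} →
    Matched g g₁ p → Matched g g₁ q → proj₁ p ≡ proj₁ q → proj₂ p ≡ proj₂ q
  matched-functional {g} {g₁} r (h , hl , hl₁) (k , kl , kl₁) refl =
    last-agree em (⟨ h ⟩ ++ g) (⟨ k ⟩ ++ g) (⟨ h ⟩₁ ++ g₁) (⟨ k ⟩₁ ++ g₁)
      (r h) (r k) (equidistant-// g g₁ h k) hl kl hl₁ kl₁

  matched-injective : ∀ {g g₁} → Equidistant g g₁ → ∀ {p q} →
    Matched g g₁ p → Matched g g₁ q → proj₂ p ≡ proj₂ q → proj₁ p ≡ proj₁ q
  matched-injective {g} {g₁} r (h , hl , hl₁) (k , kl , kl₁) refl =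
    last-agree em (⟨ h ⟩₁ ++ g₁) (⟨ k ⟩₁ ++ g₁) (⟨ h ⟩ ++ g) (⟨ k ⟩ ++ g)
      (sym (r h)) (sym (r k)) (sym (equidistant-// g g₁ h k)) hl₁ kl₁ hl kl

  -- One list of all pairs, the same for every `(g , g₁)`: filtering it gives translates the same
  -- pairs in the same order, not merely the same set. Finiteness of the degree enters here.
  candidates : List (Letter I J × Letter I₁ J₁)
  candidates = cartesianProduct ls (map (Inverse.to base) ls)

  candidates-complete : ∀ p → p ∈ candidates
  candidates-complete (l , l₁) = ∈-cartesianProduct⁺ (ls-complete l)
    (subst (_∈ map (Inverse.to base) ls) (Inverse.strictlyInverseˡ base l₁)
      (∈-map⁺ (Inverse.to base) (ls-complete (Inverse.from base l₁))))

  pairs : Word I J → Word I₁ J₁ → List (Letter I J × Letter I₁ J₁)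
  pairs g g₁ = filter (λ p → em {Matched g g₁ p}) candidates

  σ : Word I J → Word I₁ J₁ → Letter I J ↔ Letter I₁ J₁
  σ g g₁ = extend (pairs g g₁)

  module σ g g₁ = Inverse (σ g g₁)

  σ-matched : ∀ {g g₁} → Equidistant g g₁ → ∀ {l l₁} → Matched g g₁ (l , l₁) → σ.to g g₁ l ≡ l₁
  σ-matched {g} {g₁} r m = extend-∈ {Matched g g₁}
    (λ {p} {q} → matched-functional {g} {g₁} r {p} {q})
    (λ {p} {q} → matched-injective {g} {g₁} r {p} {q})
    (all-filter (λ p → em {Matched g g₁ p}) candidates)
    (∈-filter⁺ (λ p → em {Matched g g₁ p}) (candidates-complete _) m)

  Translate : H.Carrier → Word I J → Word I₁ J₁ → Word I J → Word I₁ J₁ → Set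
  Translate k g g₁ g′ g₁′ = (g G.≈ ⟨ k ⟩ ++ g′) × (g₁ G₁.≈ ⟨ k ⟩₁ ++ g₁′)

  translate-⁻¹ : ∀ k {g g₁ g′ g₁′} → Translate k g g₁ g′ g₁′ → Translate (k H.⁻¹) g′ g₁′ g g₁
  translate-⁻¹ k {g} {g₁} {g′} {g₁′} (p , q) =
      G.sym (G.trans (G.∙-congˡ {⟨ k H.⁻¹ ⟩} p) (\\-leftDividesʳ (freeProduct I J) ⟨ k ⟩ g′))
    , G₁.sym (G₁.trans (G₁.∙-cong (α.⁻¹-homo k) q) (\\-leftDividesʳ (freeProduct I₁ J₁) ⟨ k ⟩₁ g₁′))
    where open GroupProperties using (\\-leftDividesʳ)

  matched-translate : ∀ k {g g₁ g′ g₁′} → Translate k g g₁ g′ g₁′ →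
                      ∀ {p} → Matched g g₁ p → Matched g′ g₁′ p
  matched-translate k {g} {g₁} {g′} {g₁′} (p , q) (h , hl , hl₁) =
      h H.∙ k
    , trans (L.last-cong (G.trans (≡⇒≈ (++-assoc ⟨ h ⟩ ⟨ k ⟩ g′)) (G.∙-congˡ {⟨ h ⟩} (G.sym p)))) hl
    , trans (L₁.last-cong (G₁.trans (G₁.∙-congʳ {g₁′} (α.∙-homo h k))
        (G₁.trans (≡⇒≈ (++-assoc ⟨ h ⟩₁ ⟨ k ⟩₁ g₁′)) (G₁.∙-congˡ {⟨ h ⟩₁} (G₁.sym q))))) hl₁

  pairs-translate : ∀ k {g g₁ g′ g₁′} → Translate k g g₁ g′ g₁′ → pairs g g₁ ≡ pairs g′ g₁′
  pairs-translate k {g} {g₁} {g′} {g₁′} t = filter-≐ _ _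
    ( (λ {p} → matched-translate k t {p})
    , (λ {p} → matched-translate (k H.⁻¹) (translate-⁻¹ k t) {p})) candidates

  -- σ matches last letters, that is, the inverses of the letters leading away from g and g₁.
  turn : Word I J → Word I₁ J₁ → Letter I J → Letter I₁ J₁
  turn g g₁ l = inv₁ (σ.to g g₁ (inv l))

  turn⁻¹ : Word I J → Word I₁ J₁ → Letter I₁ J₁ → Letter I J
  turn⁻¹ g g₁ l = inv (σ.from g g₁ (inv₁ l))

  turn-turn⁻¹ : ∀ g g₁ l → turn g g₁ (turn⁻¹ g g₁ l) ≡ l
  turn-turn⁻¹ g g₁ l = trans (cong (inv₁ ∘ σ.to g g₁) (inv-inv _))
    (trans (cong inv₁ (σ.strictlyInverseˡ g g₁ (inv₁ l))) (inv-inv₁ l))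

  turn⁻¹-turn : ∀ g g₁ l → turn⁻¹ g g₁ (turn g g₁ l) ≡ l
  turn⁻¹-turn g g₁ l = trans (cong (inv ∘ σ.from g g₁) (inv-inv₁ _))
    (trans (cong inv (σ.strictlyInverseʳ g g₁ (inv l))) (inv-inv l))

  turn-translate : ∀ k {g g₁ g′ g₁′} → Translate k g g₁ g′ g₁′ → ∀ l → turn g g₁ l ≡ turn g′ g₁′ l
  turn-translate k t l = cong (λ ps → inv₁ (Inverse.to (extend ps) (inv l))) (pairs-translate k t)

  turn-cong : ∀ {g g₁ g′ g₁′} → g G.≈ g′ → g₁ G₁.≈ g₁′ → ∀ l → turn g g₁ l ≡ turn g′ g₁′ l
  turn-cong {g₁′ = g₁′} p q = turn-translate H.ε (p , G₁.trans q (G₁.∙-congʳ {g₁′} (G₁.sym α.ε-homo)))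

  module _ {g g₁} (r : Equidistant g g₁) where

    last⇒ : ∀ h {l} → L.last (⟨ h ⟩ ++ g) ≡ just l →
            L₁.last (⟨ h ⟩₁ ++ g₁) ≡ just (σ.to g g₁ l)
    last⇒ h {l} p with L₁.last-exists (⟨ h ⟩₁ ++ g₁)
      (trans (sym (r h)) (proj₂ (L.last⇒suc (⟨ h ⟩ ++ g) p)))
    ... | l₁ , q = trans q (cong just (sym (σ-matched {g} {g₁} r (h , p , q))))

    -- `σ` is injective on all letters, so no letter other than the last one of `hg` can be sent to
    -- the last letter of `α(h)g₁`.
    last⇐ : ∀ h {l} → L₁.last (⟨ h ⟩₁ ++ g₁) ≡ just (σ.to g g₁ l) →
            L.last (⟨ h ⟩ ++ g) ≡ just l
    last⇐ h {l} p with L.last-exists (⟨ h ⟩ ++ g)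
      (trans (r h) (proj₂ (L₁.last⇒suc (⟨ h ⟩₁ ++ g₁) p)))
    ... | m , q = trans q (cong just (begin
      m                              ≡⟨ σ.strictlyInverseʳ g g₁ m ⟨
      σ.from g g₁ (σ.to g g₁ m)      ≡⟨ cong (σ.from g g₁) (just-injective (trans (sym (last⇒ h q)) p)) ⟩
      σ.from g g₁ (σ.to g g₁ l)      ≡⟨ σ.strictlyInverseʳ g g₁ l ⟩
      l                              ∎))
      where open ≡-Reasoning

    turn-last⇒ : ∀ h {l} → L.last (⟨ h ⟩ ++ g) ≡ just (inv l) →
                 L₁.last (⟨ h ⟩₁ ++ g₁) ≡ just (inv₁ (turn g g₁ l))
    turn-last⇒ h p = trans (last⇒ h p) (cong just (sym (inv-inv₁ _)))

    turn-last⇐ : ∀ h {l} → L₁.last (⟨ h ⟩₁ ++ g₁) ≡ just (inv₁ (turn g g₁ l)) →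
                 L.last (⟨ h ⟩ ++ g) ≡ just (inv l)
    turn-last⇐ h p = last⇐ h (trans p (cong just (inv-inv₁ _)))

    -- Appending `l` shortens or lengthens `hg` by one, according to its last letter; `turn` is made
    -- so that `α(h)g₁` behaves alike for every `h`.
    equidistant-step : ∀ l → Equidistant (g ++ l ∷ []) (g₁ ++ turn g g₁ l ∷ [])
    equidistant-step l h = begin
      L.∥ ⟨ h ⟩ ++ (g ++ l ∷ []) ∥                ≡⟨ cong L.∥_∥ (++-assoc ⟨ h ⟩ g (l ∷ [])) ⟨
      L.∥ (⟨ h ⟩ ++ g) ++ l ∷ [] ∥                ≡⟨ eq em ⟩
      L₁.∥ (⟨ h ⟩₁ ++ g₁) ++ turn g g₁ l ∷ [] ∥   ≡⟨ cong L₁.∥_∥ (++-assoc ⟨ h ⟩₁ g₁ _) ⟩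
      L₁.∥ ⟨ h ⟩₁ ++ (g₁ ++ turn g g₁ l ∷ []) ∥   ∎
      where
      open ≡-Reasoning
      eq : Dec (L.last (⟨ h ⟩ ++ g) ≡ just (inv l)) →
           L.∥ (⟨ h ⟩ ++ g) ++ l ∷ [] ∥ ≡ L₁.∥ (⟨ h ⟩₁ ++ g₁) ++ turn g g₁ l ∷ [] ∥
      eq (yes p) = suc-injective (trans (sym (L.∥∥-backtrack (⟨ h ⟩ ++ g) l p))
        (trans (r h) (L₁.∥∥-backtrack (⟨ h ⟩₁ ++ g₁) (turn g g₁ l) (turn-last⇒ h p))))
      eq (no ¬p) = begin
        L.∥ (⟨ h ⟩ ++ g) ++ l ∷ [] ∥               ≡⟨ cong length (L.stack-advance (⟨ h ⟩ ++ g) l ¬p) ⟩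
        suc L.∥ ⟨ h ⟩ ++ g ∥                       ≡⟨ cong suc (r h) ⟩
        suc L₁.∥ ⟨ h ⟩₁ ++ g₁ ∥                    ≡⟨ cong length (L₁.stack-advance (⟨ h ⟩₁ ++ g₁)
                                                        (turn g g₁ l) (¬p ∘ turn-last⇐ h)) ⟨
        L₁.∥ (⟨ h ⟩₁ ++ g₁) ++ turn g g₁ l ∷ [] ∥  ∎

  -- After a step that lengthens both words, `gl` ends in `l` and its partner in `turn g g₁ l`.
  -- These letters are matched at the new vertices, with `h = 1`, which determines the way back.
  turn-back : ∀ {g g₁} → Equidistant g g₁ → ∀ l → L.last g ≢ just (inv l) →
              turn (g ++ l ∷ []) (g₁ ++ turn g g₁ l ∷ []) (inv l) ≡ inv₁ (turn g g₁ l)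
  turn-back {g} {g₁} r l ¬p = cong inv₁ (begin
    σ.to g′ g₁′ (inv (inv l))    ≡⟨ cong (σ.to g′ g₁′) (inv-inv l) ⟩
    σ.to g′ g₁′ l                ≡⟨ just-injective (trans (sym last-g₁″) last-g₁′) ⟩
    turn g g₁ l                  ∎)
    where
    open ≡-Reasoning
    g′  = g ++ l ∷ []
    g₁′ = g₁ ++ turn g g₁ l ∷ []
    ε≈ : ∀ w → ⟨ H.ε ⟩₁ ++ w G₁.≈ w
    ε≈ w = G₁.∙-congʳ {w} α.ε-homo
    last-g₁″ : L₁.last (⟨ H.ε ⟩₁ ++ g₁′) ≡ just (σ.to g′ g₁′ l)
    last-g₁″ = last⇒ {g′} {g₁′} (equidistant-step {g} {g₁} r l) H.ε
      (cong head (L.stack-advance g l ¬p))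
    last-g₁′ : L₁.last (⟨ H.ε ⟩₁ ++ g₁′) ≡ just (turn g g₁ l)
    last-g₁′ = trans (L₁.last-cong (ε≈ g₁′)) (cong head (L₁.stack-advance g₁ (turn g g₁ l)
      (λ q → ¬p (turn-last⇐ {g} {g₁} r H.ε (trans (L₁.last-cong (ε≈ g₁)) q)))))

  -- The tree isomorphism along paths from the root. A stack is used because the recursion has to
  -- remove the step taken last; `reverse s` and `Φ s` are the vertices reached before it.
  Φ : List (Letter I J) → Word I₁ J₁
  Φ []      = []
  Φ (l ∷ s) = Φ s ++ turn (reverse s) (Φ s) l ∷ []

  image : Word I J → Word I₁ J₁
  image w = Φ (reverse w)

  image-∷ʳ : ∀ w l → image (w ++ l ∷ []) ≡ image w ++ turn w (image w) l ∷ []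
  image-∷ʳ w l = trans (cong Φ (reverse-++ w (l ∷ [])))
    (cong (λ v → image w ++ turn v (image w) l ∷ []) (reverse-involutive w))

  equidistant-Φ : ∀ s → Equidistant (reverse s) (Φ s)
  equidistant-Φ []      h = begin
    L.∥ ⟨ h ⟩ ++ [] ∥     ≡⟨ cong L.∥_∥ (++-identityʳ ⟨ h ⟩) ⟩
    L.∥ ⟨ h ⟩ ∥           ≡⟨ α-∥∥ h ⟩
    L₁.∥ ⟨ h ⟩₁ ∥         ≡⟨ cong L₁.∥_∥ (++-identityʳ ⟨ h ⟩₁) ⟨
    L₁.∥ ⟨ h ⟩₁ ++ [] ∥   ∎
    where open ≡-Reasoning
  equidistant-Φ (l ∷ s) = subst (λ v → Equidistant v (Φ (l ∷ s))) (sym (unfold-reverse l s))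
    (equidistant-step {reverse s} {Φ s} (equidistant-Φ s) l)

  equidistant-image : ∀ w → Equidistant w (image w)
  equidistant-image w = subst (λ v → Equidistant v (image w)) (reverse-involutive w)
    (equidistant-Φ (reverse w))

  -- When `push` pops, the step `l` retraces the previous one, and by `turn-back` so does its image.
  Φ-push : ∀ l s → L.Reduced s → Φ s ++ turn (reverse s) (Φ s) l ∷ [] G₁.≈ Φ (L.push l s)
  Φ-push l []      _ = G₁.refl
  Φ-push l (m ∷ s) (m≢ , r) with em {m ≡ inv l}
  ... | no  _    = G₁.refl
  ... | yes refl = G₁.trans (≡⇒≈ (begin
    (Φ s ++ t ∷ []) ++ turn (reverse (inv l ∷ s)) (Φ s ++ t ∷ []) l ∷ []
      ≡⟨ ++-assoc (Φ s) (t ∷ []) _ ⟩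
    Φ s ++ t ∷ turn (reverse (inv l ∷ s)) (Φ s ++ t ∷ []) l ∷ []
      ≡⟨ cong (λ k → Φ s ++ t ∷ k ∷ []) back ⟩
    Φ s ++ t ∷ inv₁ t ∷ [] ∎))
    (G₁.trans (word-step I₁ J₁ (Φ s) t []) (G₁.identityʳ (Φ s)))
    where
    open ≡-Reasoning
    t = turn (reverse s) (Φ s) (inv l)
    back : turn (reverse (inv l ∷ s)) (Φ s ++ t ∷ []) l ≡ inv₁ t
    back = trans (cong₂ (λ v → turn v (Φ s ++ t ∷ [])) (unfold-reverse (inv l) s) (sym (inv-inv l)))
      (turn-back {reverse s} {Φ s} (equidistant-Φ s) (inv l)
        (λ q → m≢ (trans (sym (cong head (L.stack-reverse r))) q)))

  Φ-reduce : ∀ s → Φ s G₁.≈ Φ (L.stack (reverse s))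
  Φ-reduce []      = G₁.refl
  Φ-reduce (l ∷ s) = G₁.trans
    (G₁.∙-cong (Φ-reduce s) (≡⇒≈ (cong (_∷ []) (turn-cong
      (G.sym (L.reverse-stack (reverse s))) (Φ-reduce s) l))))
    (G₁.trans (Φ-push l (L.stack (reverse s)) (L.stack-reduced (reverse s)))
      (≡⇒≈ (cong Φ (trans (sym (L.stack-∷ʳ (reverse s) l)) (cong L.stack (sym (unfold-reverse l s)))))))

  image-cong : ∀ {u v} → u G.≈ v → image u G₁.≈ image v
  image-cong {u} {v} p = G₁.trans (reduce u) (G₁.trans (≡⇒≈ (cong Φ (L.stack-cong p))) (G₁.sym (reduce v)))
    where
    reduce : ∀ w → image w G₁.≈ Φ (L.stack w)
    reduce w = G₁.trans (Φ-reduce (reverse w)) (≡⇒≈ (cong (Φ ∘ L.stack) (reverse-involutive w)))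

  -- Equidistance of `h` and its image, tested on `h⁻¹`: since `h⁻¹h` has length 0, so has `α(h⁻¹)`
  -- times the image.
  image-α : ∀ h → image ⟨ h ⟩ G₁.≈ ⟨ h ⟩₁
  image-α h = G₁.trans (inverseʳ-unique ⟨ h H.⁻¹ ⟩₁ (image ⟨ h ⟩) (L₁.∥∥≡0⇒≈[] _ (begin
    L₁.∥ ⟨ h H.⁻¹ ⟩₁ ++ image ⟨ h ⟩ ∥  ≡⟨ equidistant-image ⟨ h ⟩ (h H.⁻¹) ⟨
    L.∥ ⟨ h H.⁻¹ ⟩ ++ ⟨ h ⟩ ∥          ≡⟨ L.∥∥-cong (left-inverse I J ⟨ h ⟩) ⟩
    0                                  ∎)))
    (G₁.trans (G₁.⁻¹-cong (α.⁻¹-homo h)) (⁻¹-involutive ⟨ h ⟩₁))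
    where
    open ≡-Reasoning
    open GroupProperties (freeProduct I₁ J₁) using (inverseʳ-unique; ⁻¹-involutive)

  -- Both sides start from `α(h)` and then turn alike, because `turn` is invariant under
  -- translation.
  image-equivariant : ∀ h g → image (⟨ h ⟩ ++ g) G₁.≈ ⟨ h ⟩₁ ++ image g
  image-equivariant h g = G₁.trans
    (≡⇒≈ (cong (λ v → image (⟨ h ⟩ ++ v)) (sym (reverse-involutive g)))) (go (reverse g))
    where
    go : ∀ s → image (⟨ h ⟩ ++ reverse s) G₁.≈ ⟨ h ⟩₁ ++ Φ s
    go []      = G₁.trans (image-cong (G.identityʳ ⟨ h ⟩))
                   (G₁.trans (image-α h) (G₁.sym (G₁.identityʳ ⟨ h ⟩₁)))
    go (l ∷ s) = begin
      image (⟨ h ⟩ ++ reverse (l ∷ s))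
        ≡⟨ cong image (trans (cong (⟨ h ⟩ ++_) (unfold-reverse l s))
                           (sym (++-assoc ⟨ h ⟩ (reverse s) _))) ⟩
      image (w ++ l ∷ [])
        ≡⟨ image-∷ʳ w l ⟩
      image w ++ turn w (image w) l ∷ []
        ≈⟨ G₁.∙-cong (go s) (≡⇒≈ (cong (_∷ []) (turn-translate h (G.refl , go s) l))) ⟩
      (⟨ h ⟩₁ ++ Φ s) ++ turn (reverse s) (Φ s) l ∷ []
        ≡⟨ ++-assoc ⟨ h ⟩₁ (Φ s) _ ⟩
      ⟨ h ⟩₁ ++ Φ (l ∷ s) ∎
      where
      open SetoidReasoning G₁.setoid
      w = ⟨ h ⟩ ++ reverse s

  letterBijections : LetterBijections H I₁ J₁
  letterBijections = record
    { to         = λ g → turn g (image g)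
    ; from       = λ g → turn⁻¹ g (image g)
    ; to-from    = λ g → turn-turn⁻¹ g (image g)
    ; from-to    = λ g → turn⁻¹-turn g (image g)
    ; to-cong    = coset-invariant
    ; to-inverse = λ g l → turn-inverse g l em
    }
    where
    open ≡-Reasoning

    coset-invariant : ∀ {g g′} → _≈coset_ H g g′ → ∀ l → turn g (image g) l ≡ turn g′ (image g′) l
    coset-invariant {g} {g′} p = turn-translate k
      (g≈ , G₁.trans (image-cong g≈) (image-equivariant k g′))
      where
      k = g ++ word⁻¹ I J g′ , p
      g≈ : g G.≈ ⟨ k ⟩ ++ g′
      g≈ = G.sym (GroupProperties.//-rightDividesˡ (freeProduct I J) g′ g)

    turn-forth : ∀ g l → L.last g ≢ just (inv l) →
      turn (g ++ l ∷ []) (image (g ++ l ∷ [])) (inv l) ≡ inv₁ (turn g (image g) l)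
    turn-forth g l ¬p = trans
      (cong (λ v → turn (g ++ l ∷ []) v (inv l)) (image-∷ʳ g l))
      (turn-back {g} {image g} (equidistant-image g) l ¬p)

    turn-inverse : ∀ g l → Dec (L.last g ≡ just (inv l)) →
      turn (g ++ l ∷ []) (image (g ++ l ∷ [])) (inv l) ≡ inv₁ (turn g (image g) l)
    turn-inverse g l (no ¬p) = turn-forth g l ¬p
    -- Here `l` leads back towards 1. The claim is that for the reversed edge, which leads away,
    -- with both sides inverted.
    turn-inverse g l (yes p) with L.last⇒stack g p
    ... | s , e = begin
      turn (g ++ l ∷ []) (image (g ++ l ∷ [])) (inv l)  ≡⟨ turn-cong gl≈ (image-cong gl≈) (inv l) ⟩
      turn g₀ (image g₀) (inv l)                        ≡⟨ inv-inv₁ _ ⟨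
      inv₁ (inv₁ (turn g₀ (image g₀) (inv l)))          ≡⟨ cong inv₁ (turn-forth g₀ (inv l) last≢) ⟨
      inv₁ (turn g₀′ (image g₀′) (inv (inv l)))         ≡⟨ cong (inv₁ ∘ turn g₀′ (image g₀′)) (inv-inv l) ⟩
      inv₁ (turn g₀′ (image g₀′) l)                     ≡⟨ cong inv₁ (turn-cong g≈ (image-cong g≈) l) ⟨
      inv₁ (turn g (image g) l)                         ∎
      where
      g₀  = reverse s
      g₀′ = g₀ ++ inv l ∷ []
      reduced : L.Reduced (inv l ∷ s)
      reduced = subst L.Reduced e (L.stack-reduced g)
      last≢ : L.last g₀ ≢ just (inv (inv l))
      last≢ q = proj₁ reduced (trans (sym (cong head (L.stack-reverse (proj₂ reduced)))) q)
      g≈ : g G.≈ g₀′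
      g≈ = G.trans (G.sym (L.reverse-stack g)) (≡⇒≈ (trans (cong reverse e) (unfold-reverse (inv l) s)))
      gl≈ : g ++ l ∷ [] G.≈ g₀
      gl≈ = G.trans (G.∙-congʳ {l ∷ []} g≈) (G.trans
        (≡⇒≈ (trans (++-assoc g₀ (inv l ∷ []) _)
          (cong (λ k → g₀ ++ inv l ∷ k ∷ []) (sym (inv-inv l)))))
        (G.trans (word-step I J g₀ (inv l) []) (G.identityʳ g₀)))

  open LetterBijections letterBijections using (relabel)

  relabel≡image : ∀ w → relabel [] w ≡ image w
  relabel≡image w = go [] w
    where
    go : ∀ g w → image g ++ relabel g w ≡ image (g ++ w)
    go g []      = trans (++-identityʳ (image g)) (cong image (sym (++-identityʳ g)))
    go g (l ∷ w) = begin
      image g ++ turn g (image g) l ∷ relabel gl w          ≡⟨ ++-assoc (image g) (turn g (image g) l ∷ []) _ ⟨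
      (image g ++ turn g (image g) l ∷ []) ++ relabel gl w  ≡⟨ cong (_++ relabel gl w) (image-∷ʳ g l) ⟨
      image gl ++ relabel gl w                              ≡⟨ go gl w ⟩
      image (gl ++ w)                                       ≡⟨ cong image (++-assoc g (l ∷ []) w) ⟩
      image (g ++ l ∷ w)                                    ∎
      where
      open ≡-Reasoning
      gl = g ++ l ∷ []

  -- On `H` relabelling is `α` itself. Conversely, a word relabelled into `N` has the same
  -- relabelling as some `h ∈ H`, by surjectivity of `α`, and so equals it in the group.
  matches : Matches letterBijections N
  matches = record
    { mem⇒ = λ {h} h∈H → Subgroup.Mem-resp N
        (G₁.sym (G₁.trans (≡⇒≈ (relabel≡image h)) (image-α (h , h∈H)))) (proj₂ (α (h , h∈H)))
    ; mem⇐ = λ {g} n∈N →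
        let (h , αh≈) = α.surjective (relabel [] g , n∈N) in
        Subgroup.Mem-resp H (LetterBijections.relabel-injective letterBijections
          (G₁.trans (≡⇒≈ (relabel≡image ⟨ h ⟩)) (G₁.trans (image-α h) (αh≈ G.refl)))) (proj₂ h)
    }

-- From matching letter bijections to labellings

module _ {H : Subgroup (freeProduct I J)} {N : Subgroup (freeProduct I₁ J₁)}
         (b : LetterBijections H I₁ J₁) (m : Matches b N) where
  open LetterBijections b
  open Matches m
  private
    module G  = Group (freeProduct I J)
    module G₁ = Group (freeProduct I₁ J₁)
    open GroupProperties using (//-rightDividesˡ; //-rightDividesʳ)

  relabel-∼ : ∀ {g g′} → _≈coset_ H g g′ → _≈coset_ N (relabel [] g) (relabel [] g′)
  relabel-∼ {g} {g′} p = Subgroup.Mem-resp N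
    (G₁.trans (G₁.sym (//-rightDividesʳ (freeProduct I₁ J₁) (relabel [] g′) (relabel [] k)))
      (G₁.∙-congʳ {word⁻¹ I₁ J₁ (relabel [] g′)} (G₁.trans (≡⇒≈ (sym (relabel-mem-++ p g′)))
        (relabel-cong [] (//-rightDividesˡ (freeProduct I J) g′ g)))))
    (mem⇒ p)
    where k = g ++ word⁻¹ I J g′

  -- The quotient `n ∈ N` of the two images comes from some `h ∈ H`, and the relabellings of `hg′`
  -- and `g` agree in the group.
  relabel-∼⁻ : ∀ {g g′} → _≈coset_ N (relabel [] g) (relabel [] g′) → _≈coset_ H g g′
  relabel-∼⁻ {g} {g′} p = Subgroup.Mem-resp H
    (G.trans (G.sym (//-rightDividesʳ (freeProduct I J) g′ h))
      (G.∙-congʳ {word⁻¹ I J g′} (relabel-injective (G₁.trans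
        (≡⇒≈ (trans (relabel-mem-++ h∈H g′) (cong (_++ relabel [] g′) (relabel-unrelabel [] n))))
        (//-rightDividesˡ (freeProduct I₁ J₁) (relabel [] g′) (relabel [] g))))))
    h∈H
    where
    n = relabel [] g ++ word⁻¹ I₁ J₁ (relabel [] g′)
    h = unrelabel [] n
    h∈H : Subgroup.Mem H h
    h∈H = mem⇐ (subst (Subgroup.Mem N) (sym (relabel-unrelabel [] n)) p)

  relabelling : {A : Group 0ℓ 0ℓ} {K : Subgroup A} {X : GeneratingSystem A} →
                Labelling N K X → Labelling H K X
  relabelling {A} {K} {X} λs = record
    { vertex       = vertex ∘ relabel []
    ; vertex-cong  = λ {g} {g′} p → vertex-cong {relabel [] g} {relabel [] g′} (relabel-∼ {g} {g′} p)
    ; vertex-inj   = λ {g} {g′} p → relabel-∼⁻ {g} {g′} (vertex-inj p)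
    ; vertex-surj  = λ a → let (n , p) = vertex-surj a in
        unrelabel [] n , subst (λ w → _≈coset_ K (vertex w) a) (sym (relabel-unrelabel [] n)) p
    ; label        = λ g l → label (relabel [] g) (to g l)
    ; label-cong   = λ {g} {g′} l p → S.trans
        (label-cong {relabel [] g} {relabel [] g′} (to g l) (relabel-∼ {g} {g′} p))
        (S.reflexive (cong (label (relabel [] g′)) (to-cong {g} {g′} p l)))
    ; letter       = λ g m → from g (letter (relabel [] g) m)
    ; letter-cong  = λ g p → cong (from g) (letter-cong (relabel [] g) p)
    ; label-letter = λ g m → S.trans
        (S.reflexive (cong (label (relabel [] g)) (to-from g _))) (label-letter (relabel [] g) m)
    ; letter-label = λ g l → trans (cong (from g) (letter-label (relabel [] g) (to g l))) (from-to g l)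
    ; step         = λ g l → subst
        (λ w → _≈coset_ K (vertex (relabel [] g) ∙ value X (label (relabel [] g) (to g l))) (vertex w))
        (sym (relabel-∷ʳ g l)) (step (relabel [] g) (to g l))
    ; label-inv    = λ g l → S.trans (label-inv (relabel [] g) (to g l))
        (S.reflexive (cong₂ label (sym (relabel-∷ʳ g l)) (sym (to-inverse g l))))
    }
    where
    open Labelling λs
    open Group A using (_∙_)
    module S = Setoid (labels X)

-- Quotients by normal subgroups as Cayley graphs

quotient : (A : Group 0ℓ 0ℓ) (N : Subgroup A) → Normal N → Group 0ℓ 0ℓ
quotient A N normal = record
  { Carrier = Carrier
  ; _≈_     = _≈coset_ N
  ; _∙_     = _∙_
  ; ε       = ε
  ; _⁻¹     = _⁻¹
  ; isGroup = record
    { isMonoid = record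
      { isSemigroup = record
        { isMagma = record
          { isEquivalence = Setoid.isEquivalence (cosets N)
          ; ∙-cong = λ {a} {a′} {b} {b′} p q → C.trans (≈coset-∙ N b p) (∙-congˡ′ a′ q) }
        ; assoc = λ a b c → ≈⇒≈coset N (assoc a b c) }
      ; identity = (λ a → ≈⇒≈coset N (identityˡ a)) , (λ a → ≈⇒≈coset N (identityʳ a)) }
    ; inverse = (λ a → ≈⇒≈coset N (inverseˡ a)) , (λ a → ≈⇒≈coset N (inverseʳ a))
    -- `b a⁻¹ ∈ N`, and conjugating it by `b⁻¹` gives `a⁻¹ b`.
    ; ⁻¹-cong = λ {a} {b} p → Subgroup.Mem-resp N
        (∙-congʳ (\\-leftDividesʳ b (a ⁻¹))) (normal (b ⁻¹) (C.sym p))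
    }
  }
  where
  open Group A hiding (refl; sym; trans)
  open GroupProperties A
  module A = Group A
  module C = Setoid (cosets N)
  ∙-congˡ′ : ∀ a {b b′} → b C.≈ b′ → a ∙ b C.≈ a ∙ b′
  ∙-congˡ′ a {b} {b′} p = Subgroup.Mem-resp N (begin
    (a ∙ (b ∙ b′ ⁻¹)) ∙ a ⁻¹   ≈⟨ ∙-congʳ (assoc a b (b′ ⁻¹)) ⟨
    ((a ∙ b) ∙ b′ ⁻¹) ∙ a ⁻¹   ≈⟨ assoc (a ∙ b) (b′ ⁻¹) (a ⁻¹) ⟩
    (a ∙ b) ∙ (b′ ⁻¹ ∙ a ⁻¹)   ≈⟨ ∙-congˡ (⁻¹-anti-homo-∙ a b′) ⟨
    (a ∙ b) ∙ (a ∙ b′) ⁻¹      ∎) (normal a p)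
    where open SetoidReasoning A.setoid

-- Numbering words and comparing numbers

least : ExcludedMiddle 0ℓ → {P : ℕ → Set} → ∀ n → P n → ∃[ k ] (P k × ∀ {j} → P j → k ≤ j)
least em {P} = <-rec (λ n → P n → ∃[ k ] (P k × ∀ {j} → P j → k ≤ j)) λ n rec p →
  go n p (λ {k} → rec {k}) em
  where
  go : ∀ n → P n → (∀ {k} → k < n → P k → ∃[ k ] (P k × ∀ {j} → P j → k ≤ j)) →
       Dec (∃[ k ] (k < n × P k)) → ∃[ k ] (P k × ∀ {j} → P j → k ≤ j)
  go n p rec (yes (k , k<n , q)) = rec k<n q
  go n p rec (no none)           = n , p , λ {j} q → ≮⇒≥ (λ j<n → none (j , j<n , q))

compare : ℕ → ℕ → Sign
compare m n with m <? n
... | yes _ = pos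
... | no  _ = neg

compare-opposite : ∀ {m n} → m ≢ n → compare n m ≡ opposite (compare m n)
compare-opposite {m} {n} m≢n with m <? n | n <? m
... | yes p | yes q = ⊥-elim (<-asym p q)
... | yes _ | no _  = refl
... | no _  | yes _ = refl
... | no p  | no q  = ⊥-elim (m≢n (≤-antisym (≮⇒≥ q) (≮⇒≥ p)))

module Rank {L : Set} {d : ℕ} (index : L → Fin d)
            (index-injective : ∀ {l m} → index l ≡ index m → l ≡ m) where

  -- Bijective base-`d` numeration, with digits from 1 to `d`: the `suc` excludes the digit 0, so
  -- that the empty word alone has code 0.
  code : List L → ℕ
  code []      = 0
  code (l ∷ w) = suc (toℕ (index l) + code w * d)

  code-injective : ∀ u v → code u ≡ code v → u ≡ v
  code-injective []      []      _ = refl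
  code-injective (l ∷ u) (m ∷ v) p =
    cong₂ _∷_ (index-injective (toℕ-injective digits)) (code-injective u v (*-cancelʳ-≡ _ _ d
      (+-cancelˡ-≡ (toℕ (index l)) _ _ (trans p′ (cong (_+ code v * d) (sym digits))))))
    where
    instance
      d≢0 : NonZero d
      d≢0 = nonZeroIndex (index l)
    p′ = suc-injective p
    digit : ∀ l w → (toℕ (index l) + code w * d) % d ≡ toℕ (index l)
    digit l w = trans ([m+kn]%n≡m%n (toℕ (index l)) (code w) d) (m<n⇒m%n≡m (toℕ<n (index l)))
    digits : toℕ (index l) ≡ toℕ (index m)
    digits = trans (sym (digit l u)) (trans (cong (_% d) p′) (digit m v))

module _ (em : ExcludedMiddle 0ℓ) {I J : Set} {d : ℕ} (index : Letter I J → Fin d)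
         (index-injective : ∀ {l m} → index l ≡ index m → l ≡ m)
         (N : Subgroup (freeProduct I J)) (normal : Normal N) where
  private
    Q = quotient (freeProduct I J) N normal
    module Q = Group Q
    open Rank index index-injective
    inv = letter⁻¹ I J
    infix 4 _∼_
    _∼_ = _≈coset_ N
    triv = trivialSubgroup Q

    minimal : ∀ g → ∃[ k ] ((∃[ w ] (code w ≡ k × w ∼ g)) ×
                            ∀ {j} → (∃[ w ] (code w ≡ j × w ∼ g)) → k ≤ j)
    minimal g = least em (code g) (g , refl , Q.refl {g})

  -- Compares the two cosets g and g x_i without choosing representatives.
  rank : Word I J → ℕ
  rank g = proj₁ (minimal g)

  rank-cong : ∀ {g h} → g ∼ h → rank g ≡ rank h
  rank-cong {g} {h} p = ≤-antisym (bound g h (Q.sym {g} {h} p)) (bound h g p)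
    where
    bound : ∀ g h → h ∼ g → rank g ≤ rank h
    bound g h p = let (w , e , q) = proj₁ (proj₂ (minimal h)) in
      proj₂ (proj₂ (minimal g)) (w , e , Q.trans {w} {h} {g} q p)

  rank-injective : ∀ {g h} → rank g ≡ rank h → g ∼ h
  rank-injective {g} {h} e =
    let (u , eᵤ , p) = proj₁ (proj₂ (minimal g))
        (v , eᵥ , q) = proj₁ (proj₂ (minimal h))
    in Q.trans {g} {u} {h} (Q.sym {u} {g} p)
         (subst (_∼ h) (code-injective v u (trans eᵥ (trans (sym e) (sym eᵤ)))) q)

  x : I → Word I J
  x i = free i pos ∷ []

  -- Order exactly 2. If `x_i ∈ N`, the edges `x_i` and `x_i⁻¹` are two mutually inverse loops, as
  -- for a generator that is not self-inverse.
  HasOrder2 : I → Set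
  HasOrder2 i = (x i ++ x i ∼ []) × ¬ (x i ∼ [])

  order2? : ∀ i → Dec (HasOrder2 i)
  order2? i = em

  order2⇒x∼x⁻¹ : ∀ {i} → HasOrder2 i → ∀ s t → free i s ∷ [] ∼ free i t ∷ []
  order2⇒x∼x⁻¹ {i} _       pos pos = Q.refl {x i}
  order2⇒x∼x⁻¹ {i} _       neg neg = Q.refl {free i neg ∷ []}
  order2⇒x∼x⁻¹ {i} (p , _) pos neg = GroupProperties.inverseˡ-unique Q (x i) (x i) p
  order2⇒x∼x⁻¹ {i} (p , _) neg pos =
    Q.sym {x i} {free i neg ∷ []} (GroupProperties.inverseˡ-unique Q (x i) (x i) p)

  parity : I → Word I J → Sign
  parity i g = compare (rank g) (rank (g ++ x i))

  parity-cong : ∀ i {g h} → g ∼ h → parity i g ≡ parity i h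
  parity-cong i {g} {h} p = cong₂ compare (rank-cong {g} {h} p)
    (rank-cong {g ++ x i} {h ++ x i} (Q.∙-cong {g} {h} {x i} {x i} p (Q.refl {x i})))

  -- `g` and `g x_i` are distinct cosets exchanged by `x_i`, so at the other end the same two ranks
  -- are compared in the opposite order.
  parity-x : ∀ {i} → HasOrder2 i → ∀ g → parity i (g ++ x i) ≡ opposite (parity i g)
  parity-x {i} (xx , x≁) g = trans
    (cong (compare (rank (g ++ x i))) (rank-cong {(g ++ x i) ++ x i} {g} gxx∼g))
    (compare-opposite λ e → x≁ (GroupProperties.identityʳ-unique Q g (x i)
      (rank-injective {g ++ x i} {g} (sym e))))
    where
    gxx∼g : (g ++ x i) ++ x i ∼ g
    gxx∼g = Q.trans {(g ++ x i) ++ x i} {g ++ (x i ++ x i)} {g} (Q.assoc g (x i) (x i))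
      (Q.trans {g ++ (x i ++ x i)} {g ++ []} {g}
        (Q.∙-cong {g} {g} {x i ++ x i} {[]} (Q.refl {g}) xx) (Q.identityʳ g))

  parity-step : ∀ {i} → HasOrder2 i → ∀ g s → parity i (g ++ free i s ∷ []) ≡ opposite (parity i g)
  parity-step {i} o g s = trans
    (parity-cong i {g ++ free i s ∷ []} {g ++ x i}
      (Q.∙-cong {g} {g} {free i s ∷ []} {x i} (Q.refl {g}) (order2⇒x∼x⁻¹ o s pos)))
    (parity-x o g)

  -- When x_i has order 2, the kept letters x_i and x_i⁻¹ are two self-inverse generators.  The
  -- edge of g along x_i^s then gets the one of sign s times the parity of g: passing to g x_i
  -- flips both signs, so that an edge and its inverse carry the same label.
  Kept : Letter I J → Set
  Kept (free i pos) = ⊤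
  Kept (free i neg) = True (order2? i)
  Kept (invol j)    = ⊤

  quotientGenerators : GeneratingSystem Q
  quotientGenerators = record
    { Index        = Σ (Letter I J) Kept
    ; gen          = gen
    ; generates    = λ w → let (v , e) = generates w in v , ≈⇒≈coset N (≡⇒≈ e)
    ; SelfInverse  = SelfInverse
    ; self⇒order≤2 = λ {k} p → 2 , s≤s z≤n , s≤s (s≤s z≤n) , square k p
    ; order2⇒self  = λ {k} p q → self k p q
    }
    where
    gen : Σ (Letter I J) Kept → Word I J
    gen (l , _) = l ∷ []
    generates : ∀ w → ∃[ v ] signedProduct Q gen v ≡ w
    generates []      = [] , refl
    generates (free i pos ∷ w) = let (v , e) = generates w in
      ((free i pos , tt) , pos) ∷ v , cong (free i pos ∷_) e
    generates (free i neg ∷ w) = let (v , e) = generates w in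
      ((free i pos , tt) , neg) ∷ v , cong (free i neg ∷_) e
    generates (invol j ∷ w)    = let (v , e) = generates w in
      ((invol j , tt) , pos) ∷ v , cong (invol j ∷_) e
    SelfInverse : Σ (Letter I J) Kept → Set
    SelfInverse (free i _ , _) = True (order2? i)
    -- This includes `y_j ∈ N`, where the edge is a loop with `ē = e`.
    SelfInverse (invol _ , _)  = ⊤
    square : ∀ k → SelfInverse k → gen k ++ gen k ∼ []
    square (free i pos , _) t = proj₁ (toWitness t)
    square (free i neg , _) t = Q.trans {y ++ y} {x i ++ x i} {[]}
      (Q.∙-cong {y} {x i} {y} {x i} y∼x y∼x) (proj₁ (toWitness t))
      where
      y = free i neg ∷ []
      y∼x = order2⇒x∼x⁻¹ {i} (toWitness t) neg pos
    square (invol j , _)    _ = ≈⇒≈coset N {invol j ∷ invol j ∷ []} {[]} (word-step I J [] (invol j) [])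
    self : ∀ k → OrderAtMost Q 2 (gen k) → ¬ OrderAtMost Q 1 (gen k) → SelfInverse k
    self (free i pos , _) (1 , p , _ , e) q = ⊥-elim (q (1 , p , p , e))
    self (free i pos , _) (2 , _ , _ , e) q =
      fromWitness (e , λ e′ → q (1 , s≤s z≤n , s≤s z≤n , e′))
    self (free i pos , _) (suc (suc (suc _)) , _ , s≤s (s≤s ()) , _) _
    self (free i neg , t) _ _ = t
    self (invol _ , _)    _ _ = tt

  private
    X = quotientGenerators

    keep : ∀ i → Sign → True (order2? i) → Σ (Letter I J) Kept
    keep i pos t = free i pos , tt
    keep i neg t = free i neg , t

    keep-self : ∀ i s t → GeneratingSystem.SelfInverse X (keep i s t)
    keep-self i pos t = t
    keep-self i neg t = t

    label : Word I J → Letter I J → Letter± X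
    label g (free i s) = classify (order2? i)
      (λ t → keep i (s Sign.* parity i g) t , pos) (λ _ → (free i pos , tt) , s)
    label g (invol j)  = (invol j , tt) , pos

    letter : Word I J → Letter± X → Letter I J
    letter g ((free i pos , _) , s) = classify (order2? i)
      (λ _ → free i (pos Sign.* parity i g)) (λ _ → free i s)
    letter g ((free i neg , _) , _) = free i (neg Sign.* parity i g)
    letter g ((invol j , _) , _)    = invol j

    *-cancel : ∀ s t → (s Sign.* t) Sign.* t ≡ s
    *-cancel pos pos = refl
    *-cancel pos neg = refl
    *-cancel neg pos = refl
    *-cancel neg neg = refl

    opposite-*-opposite : ∀ s t → opposite s Sign.* opposite t ≡ s Sign.* t
    opposite-*-opposite pos pos = refl
    opposite-*-opposite pos neg = refl
    opposite-*-opposite neg pos = refl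
    opposite-*-opposite neg neg = refl

    label-cong : ∀ {g h} l → g ∼ h → _≈label_ X (label g l) (label h l)
    label-cong {g} {h} (free i s) p rewrite parity-cong i {g} {h} p = same
    label-cong (invol j)  p = same

    letter-cong : ∀ g {m n} → _≈label_ X m n → letter g m ≡ letter g n
    letter-cong g same = refl
    letter-cong g (fold {k = free i pos , _} t) = classify-true (order2? i) (toWitness t)
    letter-cong g (fold {k = free i neg , _} _) = refl
    letter-cong g (fold {k = invol j , _} _)    = refl

    label-twisted : ∀ g i s (t : True (order2? i)) →
                    label g (free i (s Sign.* parity i g)) ≡ (keep i s t , pos)
    label-twisted g i s t = trans (classify-True (order2? i) t)
      (cong (λ r → keep i r t , pos) (*-cancel s (parity i g)))

    label-letter : ∀ g m → _≈label_ X (label g (letter g m)) m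
    label-letter g ((free i pos , tt) , s) = classify-elim (order2? i)
      (λ l → _≈label_ X (label g l) ((free i pos , tt) , s))
      (λ t → subst (λ n → _≈label_ X n ((free i pos , tt) , s)) (sym (label-twisted g i pos t)) (fold t))
      (λ f → Setoid.reflexive (labels X) (classify-False (order2? i) f))
    label-letter g ((free i neg , t) , s) =
      subst (λ n → _≈label_ X n ((free i neg , t) , s)) (sym (label-twisted g i neg t)) (fold t)
    label-letter g ((invol j , tt) , s)   = fold tt

    letter-keep : ∀ g i s t → letter g (keep i s t , pos) ≡ free i (s Sign.* parity i g)
    letter-keep g i pos t = classify-True (order2? i) t
    letter-keep g i neg t = refl

    letter-label : ∀ g l → letter g (label g l) ≡ l
    letter-label g (free i s) = classify-elim (order2? i) (λ m → letter g m ≡ free i s)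
      (λ t → trans (letter-keep g i (s Sign.* parity i g) t) (cong (free i) (*-cancel s (parity i g))))
      (λ f → classify-False (order2? i) f)
    letter-label g (invol j)  = refl

    value-label : ∀ g l → value X (label g l) ∼ l ∷ []
    value-label g (invol j)  = Q.refl {invol j ∷ []}
    value-label g (free i s) = classify-elim (order2? i) (λ m → value X m ∼ free i s ∷ [])
      (λ t → kept (s Sign.* parity i g) t) (λ _ → plain s)
      where
      kept : ∀ r t → value X (keep i r t , pos) ∼ free i s ∷ []
      kept pos t = order2⇒x∼x⁻¹ (toWitness t) pos s
      kept neg t = order2⇒x∼x⁻¹ (toWitness t) neg s
      plain : ∀ s → value X ((free i pos , tt) , s) ∼ free i s ∷ []
      plain pos = Q.refl {free i pos ∷ []}
      plain neg = Q.refl {free i neg ∷ []}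

    label-inv : ∀ g l → _≈label_ X (invert X (label g l)) (label (g ++ l ∷ []) (inv l))
    label-inv g (invol j)  = fold tt
    label-inv g (free i s) = classify-elim (order2? i)
      (λ m → _≈label_ X (invert X m) (label (g ++ free i s ∷ []) (free i (opposite s))))
      (λ t → subst (_≈label_ X (keep i (s Sign.* parity i g) t , neg)) (sym (begin
          label (g ++ free i s ∷ []) (free i (opposite s))
            ≡⟨ classify-True (order2? i) t ⟩
          (keep i (opposite s Sign.* parity i (g ++ free i s ∷ [])) t , pos)
            ≡⟨ cong (λ r → keep i (opposite s Sign.* r) t , pos) (parity-step (toWitness t) g s) ⟩
          (keep i (opposite s Sign.* opposite (parity i g)) t , pos)
            ≡⟨ cong (λ r → keep i r t , pos) (opposite-*-opposite s (parity i g)) ⟩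
          (keep i (s Sign.* parity i g) t , pos) ∎))
        (fold (keep-self i (s Sign.* parity i g) t)))
      (λ f → Setoid.reflexive (labels X) (sym (classify-False (order2? i) f)))
      where open ≡-Reasoning

  quotientLabelling : Labelling N triv quotientGenerators
  quotientLabelling = record
    { vertex       = id
    ; vertex-cong  = λ {g} {h} p → ≈⇒≈coset triv {g} {h} p
    ; vertex-inj   = λ {g} {h} p → GroupProperties.x∙y⁻¹≈ε⇒x≈y Q g h p
    ; vertex-surj  = λ a → a , ≈⇒≈coset triv {a} {a} (Q.refl {a})
    ; label        = label
    ; label-cong   = λ {g} {h} → label-cong {g} {h}
    ; letter       = letter
    ; letter-cong  = letter-cong
    ; label-letter = label-letter
    ; letter-label = letter-label
    ; step         = λ g l → ≈⇒≈coset triv {g ++ value X (label g l)} {g ++ l ∷ []}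
        (Q.∙-cong {g} {g} {value X (label g l)} {l ∷ []} (Q.refl {g}) (value-label g l))
    ; label-inv    = label-inv
    }

-- From length isomorphisms to Cayley graphs, in finite degree

module _ (em : ExcludedMiddle 0ℓ) {I J : Set} (H : Subgroup (freeProduct I J))
         (finite : FiniteDegree (standard I J)) where
  private
    d = proj₁ finite

    enumeration : Letter I J ↔ Fin d
    enumeration = Composition.inverse (Symmetry.inverse (degree↔letters I J)) (proj₂ finite)

    ls : List (Letter I J)
    ls = map (Inverse.from enumeration) (allFin d)

    ls-complete : ∀ l → l ∈ ls
    ls-complete l = subst (_∈ ls) (Inverse.strictlyInverseʳ enumeration l)
      (∈-map⁺ (Inverse.from enumeration) (∈-allFin (Inverse.to enumeration l)))

  lengthIsomorphicToNormal⇒cayley : LengthIsomorphicToNormal I J H → IsCayley (Sch (standard I J) H)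
  lengthIsomorphicToNormal⇒cayley (I₁ , J₁ , degrees , N , normal , α , α-iso , α-length) =
    quotient (freeProduct I₁ J₁) N normal , Y , φ
    where
    base : Letter I J ↔ Letter I₁ J₁
    base = Composition.inverse (Symmetry.inverse (degree↔letters I J))
      (Composition.inverse degrees (degree↔letters I₁ J₁))

    -- Equality of degrees makes the letters of the second group finite in number too, which the
    -- coding of its words uses.
    enumeration₁ : Letter I₁ J₁ ↔ Fin d
    enumeration₁ = Composition.inverse (Symmetry.inverse base) enumeration

    enumeration₁-injective : ∀ {l m} → Inverse.to enumeration₁ l ≡ Inverse.to enumeration₁ m → l ≡ m
    enumeration₁-injective {l} {m} e = trans (sym (Inverse.strictlyInverseʳ enumeration₁ l))
      (trans (cong (Inverse.from enumeration₁) e) (Inverse.strictlyInverseʳ enumeration₁ m))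

    open LengthIso em H N α α-iso α-length base ls ls-complete using (letterBijections; matches)

    Y : GeneratingSystem (quotient (freeProduct I₁ J₁) N normal)
    Y = quotientGenerators em (Inverse.to enumeration₁) enumeration₁-injective N normal

    toCayley : Labelling H (trivialSubgroup (quotient (freeProduct I₁ J₁) N normal)) Y
    toCayley = relabelling {N = N} letterBijections matches
      (quotientLabelling em (Inverse.to enumeration₁) enumeration₁-injective N normal)

    φ : Sch (standard I J) H ≅ Cay Y
    φ = ≅-trans {Sch (standard I J) H} {letterGraph H} {Cay Y}
      (≅-sym {letterGraph H} {Sch (standard I J) H}
        (labelling⇒≅ {X = standard I J} (standardLabelling I J H)))
      (labelling⇒≅ {X = Y} toCayley)

theorem4p16 : ExcludedMiddle 0ℓ →
    (I J : Set) (H : Subgroup (freeProduct I J)) →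
    (IsCayley (Sch (standard I J) H) → LengthIsomorphicToNormal I J H)
    × (FiniteDegree (standard I J) →
    LengthIsomorphicToNormal I J H → IsCayley (Sch (standard I J) H))
theorem4p16 em I J H =
    (λ (A , X , φ) → cayley⇒lengthIsomorphicToNormal em H X φ)
  , lengthIsomorphicToNormal⇒cayley em H
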